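{- For a nonnegative integer $n$, let $p_{3,3}(n)$ be defined by $\sum_{n\geq0}p_{3,3}(n)q^n=\frac{1}{(q;q)_\infty^3(q^3;q^3)_\infty^3}$. Then for all integers $n\geq0$ and $\alpha\geq1$, \begin{align*} p_{3,3}\left(3^{\alpha}n+\tfrac{3^{\alpha}+1}{2}\right) &\equiv0\pmod{3^{\alpha+1}},\\ p_{3,3}\left(3^{\alpha+1}n+\tfrac{5\cdot3^{\alpha}+1}{2}\right) &\equiv0\pmod{3^{\alpha+4}}. \end{align*}
   Context: $(a;q)_\infty=\prod_{n\ge0}(1-aq^n)$. $p_{3,3}(n)$ counts 2-color partition triples of $n$ where one of the colors appears only in parts that are multiples of $3$. -}

module Defs where

open import Data.Nat using (ℕ; zero; suc; _+_; _*_; _∸_; _≤ᵇ_)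
open import Data.Bool using (if_then_else_)
open import Data.List using (List; map; upTo)
open import Data.Nat.ListAction using (sum)

Series : Set
Series = ℕ → ℕ

Σ≤ : ℕ → (ℕ → ℕ) → ℕ
Σ≤ n g = sum (map g (upTo (suc n)))

-- Multiplication of f by the geometric series 1/(1 - q^k), for k ≥ 1:
-- coefficient n is Σ_{j ≥ 0, j*k ≤ n} f (n - j*k).
divOneMinus : ℕ → Series → Series
divOneMinus k f n = Σ≤ n (λ j → if j * k ≤ᵇ n then f (n ∸ j * k) else 0)

divPoch : ℕ → ℕ → Series → Series
divPoch s zero f = f
divPoch s (suc m) f = divOneMinus (s * suc m) (divPoch s m f)

one : Series
one zero = 1
one (suc _) = 0

-- 1/((q;q)_∞^3 (q^3;q^3)_∞^3), coefficient n.  Only factors (1 - q^i) with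
-- i ≤ n can affect the coefficient of q^n, so truncating at i ≤ n is exact.
genSeries : ℕ → Series
genSeries N =
  divPoch 3 N (divPoch 3 N (divPoch 3 N
    (divPoch 1 N (divPoch 1 N (divPoch 1 N one)))))

p33 : ℕ → ℕ
p33 n = genSeries n n

{-# OPTIONS --safe #-}

-- Write E for (q;q)_∞, φ for f(q) ↦ f(q³) and S_r for the extraction of the exponents congruent to r mod 3.
-- Jacobi's identity E³ = Σ (−1)ᵏ (2k+1) q^{k(k+1)/2} gives E³ = A − 3B with A = φ(a) and B = q φ²(E)³, and
-- taking norms (products over the cube roots of unity) gives A³ − 27B³ = φ(E¹² / φ(E)³).  Hence 1/E³ is
-- φ(κ)(A² + 3AB + 9B²) with κ = φ(E)³ / E¹², and the generating function of p33(3n + 2) is 9 φ(E)⁹ / E¹⁵.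
-- Put t = q φ(E)¹² / E¹², s = 27t and z = 3B/E³.  Then s = 9(z + 3z² + 3z³) and z³ = φ(s)(1 + 3z + 3z²), so
-- every element of ℤ[s] is a combination of 1, z, z² over φ(ℤ[s]), from which one reads off that S₁ maps
-- (φ(E)⁹ / E¹⁵) ℤ[s] into 3 (φ(E)⁹ / E¹⁵) ℤ[s].  Iterating, the generating function of
-- p33(3^α n + (3^α + 1)/2) lies in 3^{α+1} (φ(E)⁹ / E¹⁵) ℤ[s].  The second congruence follows because
-- s ≡ 0 mod 27 and S₂(1/E¹⁵) ≡ 0 mod 27.
module Submission where

open import Algebra.Bundles using (CommutativeRing)
import Algebra.Solver.Ring as RingSolver
open import Algebra.Solver.Ring.AlmostCommutativeRing using (fromCommutativeRing; _-Raw-AlmostCommutative⟶_)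
open import Algebra.Structures using (IsCommutativeRing)
open import Data.Bool.Base using (T; true; false; if_then_else_)
open import Data.Fin.Base using (Fin; toℕ)
open import Data.Fin.Patterns using (0F; 1F; 2F)
open import Data.Fin.Properties using (toℕ<n)
open import Data.Integer.Base as ℤ using (ℤ; +_; 0ℤ; 1ℤ)
open import Data.Integer.Divisibility.Signed as ℤ∣ using (∣⇒∣ᵤ)
import Data.Integer.Properties as ℤ
open import Data.Integer.Solver using (module +-*-Solver)
open import Data.List.Base using (List; []; _∷_; applyUpTo)
open import Data.List.Properties using (map-upTo)
open import Data.Maybe.Base using (Maybe; just; nothing)
open import Data.Nat.Base as ℕ using (ℕ; zero; suc; z≤n; s≤s; _∸_; _≤ᵇ_)
import Data.Nat.DivMod as ℕ
open import Data.Nat.Divisibility using (_∣_)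
open import Data.Nat.ListAction using (sum)
import Data.Nat.Properties as ℕ
open import Data.Nat.Tactic.RingSolver using (solve-∀)
open import Data.Product.Base using (_,_; proj₂; ∃-syntax; _×_)
open import Defs
open import Function.Base using (_∘_)
open import Level using (0ℓ)
open import Relation.Binary.Bundles using (Setoid)
open import Relation.Binary.PropositionalEquality as ≡ using (_≡_; refl; cong; cong₂)
import Relation.Binary.Reasoning.Setoid as SetoidReasoning
open import Relation.Nullary.Decidable using (yes; no)
open import Relation.Nullary.Negation using (contradiction)

-- The scalings z = 3y and s = 27t are what make the iteration gain a factor 3 each time. Without
-- them the step fails: S₀(y⁶) = t² + ... is not divisible by 3, so ℤ[t] in place of ℤ[s] would not
-- do. With coordinates taken in 1, z, z² the missing 3 is built in. The section S₁ of φ(E)⁹ / E¹⁵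
-- times f is reached through S₀(y⁵ f): the power y⁵ contains exactly 1/E¹⁵, a series in q³, and q⁵,
-- which moves the residue class 1 to the class 0. Thus only the sections S₀(yⁱ) are needed, and
-- S₀(y), S₀(y²) and the cubic equation of y determine them all. Neither roots of unity nor a second
-- variable occur. The norm is a cubic form in the three sections of a series, and Jacobi's identity
-- comes from the explicit coefficients of a finite triple product. Infinite products are handled by
-- congruences modulo powers of q, where the loss and gain of precision has to be tracked: a section
-- divides the precision by 3, a factor q^k adds k to it.

-- The ring of formal power series over ℤ.

module FormalPowerSeries where
  PowerSeries : Set
  PowerSeries = ℕ → ℤ

  infix 4 _≈_
  -- A record instead of a bare function type, so that unification can recover both series from the
  -- type of a proof.
  record _≈_ (f g : PowerSeries) : Set where
    constructor pointwise
    field coeff : ∀ n → f n ≡ g n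
  open _≈_ public

  -- Opacity keeps unification and the ring solver from unfolding series into coefficients.
  opaque
    infixl 6 _+_
    infixl 7 _*_
    infix 8 -_

    _+_ : PowerSeries → PowerSeries → PowerSeries
    (f + g) n = f n ℤ.+ g n

    -_ : PowerSeries → PowerSeries
    (- f) n = ℤ.- f n

    -- The Cauchy product in Horner form, f g = f(0) g + q (shifted f) g, which is structural in the
    -- index.
    _*_ : PowerSeries → PowerSeries → PowerSeries
    (f * g) zero    = f 0 ℤ.* g 0
    (f * g) (suc n) = f 0 ℤ.* g (suc n) ℤ.+ (f ∘ suc * g) n

    const : ℤ → PowerSeries
    const c zero    = c
    const c (suc n) = 0ℤ

    q : PowerSeries
    q zero    = 0ℤ
    q (suc n) = const 1ℤ n

  opaque
    unfolding _+_

    private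
      zero-* : ∀ f g → (∀ n → f n ≡ 0ℤ) → ∀ n → (f * g) n ≡ 0ℤ
      zero-* f g f≡0 zero = cong (ℤ._* g 0) (f≡0 0)
      zero-* f g f≡0 (suc n) rewrite f≡0 0 | zero-* (f ∘ suc) g (λ i → f≡0 (suc i)) n = refl

    const-*-coeff : ∀ c f n → (const c * f) n ≡ c ℤ.* f n
    const-*-coeff c f zero    = refl
    const-*-coeff c f (suc n)
      rewrite zero-* (const c ∘ suc) f (λ _ → refl) n = ℤ.+-identityʳ _

    q-*-suc : ∀ f n → (q * f) (suc n) ≡ f n
    q-*-suc f n = ≡.trans (ℤ.+-identityˡ _)
      (≡.trans (const-*-coeff 1ℤ f n) (ℤ.*-identityˡ (f n)))

    q-*-zero : ∀ f → (q * f) 0 ≡ 0ℤ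
    q-*-zero f = refl

    *-cong-below : ∀ {f f′ g g′} n → (∀ i → i ℕ.≤ n → f i ≡ f′ i) →
      (∀ i → i ℕ.≤ n → g i ≡ g′ i) → (f * g) n ≡ (f′ * g′) n
    *-cong-below zero f≡ g≡ = cong₂ ℤ._*_ (f≡ 0 z≤n) (g≡ 0 z≤n)
    *-cong-below (suc n) f≡ g≡ = cong₂ ℤ._+_
      (cong₂ ℤ._*_ (f≡ 0 z≤n) (g≡ (suc n) ℕ.≤-refl))
      (*-cong-below n (λ i i≤n → f≡ (suc i) (s≤s i≤n))
                      (λ i i≤n → g≡ i (ℕ.m≤n⇒m≤1+n i≤n)))

    private
      *-comm′ : ∀ f g n → (f * g) n ≡ (g * f) n
      -- Mirror image of the defining recursion: it splits off the constant term of g instead of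
      -- that of f. Commutativity follows by comparing the two.
      *-suc′ : ∀ f g n → (f * g) (suc n) ≡ f (suc n) ℤ.* g 0 ℤ.+ (f * g ∘ suc) n

      *-suc′ f g zero = ℤ.+-comm (f 0 ℤ.* g 1) (f 1 ℤ.* g 0)
      *-suc′ f g (suc n) rewrite *-suc′ (f ∘ suc) g n =
        solve 3 (λ a b c → a :+ (b :+ c) := b :+ (a :+ c)) refl
          (f 0 ℤ.* g (suc (suc n))) (f (suc (suc n)) ℤ.* g 0) ((f ∘ suc * g ∘ suc) n)
        where open +-*-Solver

      *-comm′ f g zero = ℤ.*-comm (f 0) (g 0)
      *-comm′ f g (suc n) rewrite *-suc′ g f n | *-comm′ (f ∘ suc) g n =
        cong (ℤ._+ (g * f ∘ suc) n) (ℤ.*-comm (f 0) (g (suc n)))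

      *-distribʳ′ : ∀ h f g n → ((f + g) * h) n ≡ (f * h) n ℤ.+ (g * h) n
      *-distribʳ′ h f g zero = ℤ.*-distribʳ-+ (h 0) (f 0) (g 0)
      *-distribʳ′ h f g (suc n) rewrite *-distribʳ′ h (f ∘ suc) (g ∘ suc) n =
        solve 5 (λ a b c x y → (a :+ b) :* c :+ (x :+ y) := (a :* c :+ x) :+ (b :* c :+ y)) refl
          (f 0) (g 0) (h (suc n)) ((f ∘ suc * h) n) ((g ∘ suc * h) n)
        where open +-*-Solver

      scale-* : ∀ c f g n → ((λ i → c ℤ.* f i) * g) n ≡ c ℤ.* (f * g) n
      scale-* c f g zero = ℤ.*-assoc c (f 0) (g 0)
      scale-* c f g (suc n) rewrite scale-* c (f ∘ suc) g n =
        solve 4 (λ c a b x → c :* a :* b :+ c :* x := c :* (a :* b :+ x)) refl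
          c (f 0) (g (suc n)) ((f ∘ suc * g) n)
        where open +-*-Solver

      *-assoc′ : ∀ f g h n → (f * g * h) n ≡ (f * (g * h)) n
      *-assoc′ f g h zero = ℤ.*-assoc (f 0) (g 0) (h 0)
      *-assoc′ f g h (suc n)
        rewrite *-distribʳ′ h (λ i → f 0 ℤ.* g (suc i)) (f ∘ suc * g) n
              | *-assoc′ (f ∘ suc) g h n
              | scale-* (f 0) (g ∘ suc) h n =
        solve 5 (λ a b c x y → a :* b :* c :+ (a :* x :+ y) := a :* (b :* c :+ x) :+ y) refl
          (f 0) (g 0) (h (suc n)) ((g ∘ suc * h) n) ((f ∘ suc * (g * h)) n)
        where open +-*-Solver

      *-identityˡ′ : ∀ f n → (const 1ℤ * f) n ≡ f n
      *-identityˡ′ f n = ≡.trans (const-*-coeff 1ℤ f n) (ℤ.*-identityˡ (f n))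

    series-isCommutativeRing : IsCommutativeRing _≈_ _+_ _*_ -_ (const 0ℤ) (const 1ℤ)
    series-isCommutativeRing = record
      { isRing = record
        { +-isAbelianGroup = record
          { isGroup = record
            { isMonoid = record
              { isSemigroup = record
                { isMagma = record
                  { isEquivalence = record
                    { refl = pointwise λ _ → refl
                    ; sym = λ p → pointwise λ n → ≡.sym (coeff p n)
                    ; trans = λ p r → pointwise λ n → ≡.trans (coeff p n) (coeff r n) }
                  ; ∙-cong = λ p r → pointwise λ n → cong₂ ℤ._+_ (coeff p n) (coeff r n) }
                ; assoc = λ f g h → pointwise λ n → ℤ.+-assoc (f n) (g n) (h n) }
              ; identity = (λ f → pointwise λ { zero → ℤ.+-identityˡ _ ; (suc n) → ℤ.+-identityˡ _ })
                         , (λ f → pointwise λ { zero → ℤ.+-identityʳ _ ; (suc n) → ℤ.+-identityʳ _ }) }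
            ; inverse = (λ f → pointwise λ { zero → ℤ.+-inverseˡ (f 0) ; (suc n) → ℤ.+-inverseˡ (f (suc n)) })
                      , (λ f → pointwise λ { zero → ℤ.+-inverseʳ (f 0) ; (suc n) → ℤ.+-inverseʳ (f (suc n)) })
            ; ⁻¹-cong = λ p → pointwise λ n → cong ℤ.-_ (coeff p n) }
          ; comm = λ f g → pointwise λ n → ℤ.+-comm (f n) (g n) }
        ; *-cong = λ p r → pointwise λ n → *-cong-below n (λ i _ → coeff p i) (λ i _ → coeff r i)
        ; *-assoc = λ f g h → pointwise (*-assoc′ f g h)
        ; *-identity = (λ f → pointwise (*-identityˡ′ f))
                     , (λ f → pointwise λ n → ≡.trans (*-comm′ f _ n) (*-identityˡ′ f n))
        ; distrib = (λ h f g → pointwise λ n → ≡.trans (*-comm′ h (f + g) n)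
                      (≡.trans (*-distribʳ′ h f g n) (cong₂ ℤ._+_ (*-comm′ f h n) (*-comm′ g h n))))
                  , (λ h f g → pointwise (*-distribʳ′ h f g)) }
      ; *-comm = λ f g → pointwise (*-comm′ f g) }

  seriesRing : CommutativeRing 0ℓ 0ℓ
  seriesRing = record { isCommutativeRing = series-isCommutativeRing }

  open CommutativeRing seriesRing public using
    ( setoid; semiring; +-cong; *-cong; -‿cong; *-comm; *-assoc
    ; +-identityˡ; *-identityˡ; *-identityʳ; zeroˡ; zeroʳ)
    renaming (refl to ≈-refl; sym to ≈-sym; trans to ≈-trans; reflexive to ≈-reflexive)

  opaque
    unfolding _+_

    const-+ : ∀ a b → const (a ℤ.+ b) ≈ const a + const b
    const-+ a b = pointwise λ { zero → refl ; (suc n) → refl }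

    const-* : ∀ a b → const (a ℤ.* b) ≈ const a * const b
    const-* a b = pointwise λ
      { zero → refl ; (suc n) → ≡.sym (≡.trans (const-*-coeff a (const b) (suc n)) (ℤ.*-zeroʳ a)) }

    const-neg : ∀ a → const (ℤ.- a) ≈ - const a
    const-neg a = pointwise λ { zero → refl ; (suc n) → refl }

  private
    constMorphism : ℤ.+-*-rawRing -Raw-AlmostCommutative⟶ fromCommutativeRing seriesRing
    constMorphism = record
      { ⟦_⟧ = const ; +-homo = const-+ ; *-homo = const-* ; -‿homo = const-neg
      ; 0-homo = ≈-refl ; 1-homo = ≈-refl }

    const≟ : ∀ a b → Maybe (const a ≈ const b)
    const≟ a b with a ℤ.≟ b
    ... | yes a≡b = just (≈-reflexive (cong const a≡b))
    ... | no _    = nothing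

  -- Solver coefficients are integers embedded by `const`, so numerals are computed with and not
  -- treated as atoms.
  module SeriesSolver =
    RingSolver ℤ.+-*-rawRing (fromCommutativeRing seriesRing) constMorphism const≟

  open import Algebra.Properties.Semiring.Exp semiring public using (_^_; ^-homo-*; ^-assocʳ; ^-congʳ; ^-congˡ)

  0s 1s : PowerSeries
  0s = const 0ℤ
  1s = const 1ℤ

  infix 8 1-_
  1-_ : PowerSeries → PowerSeries
  1- f = 1s + - f

  cube pow4 pow5 : PowerSeries → PowerSeries
  cube x = x * x * x
  pow4 x = x * x * x * x
  pow5 x = x * x * x * x * x

  cube-cong : ∀ {x y} → x ≈ y → cube x ≈ cube y
  cube-cong p = *-cong (*-cong p p) p

  pow5-cong : ∀ {x y} → x ≈ y → pow5 x ≈ pow5 y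
  pow5-cong p = *-cong (*-cong (*-cong (*-cong p p) p) p) p

  open SeriesSolver public using (Polynomial; solve; con; _:=_; _:+_; _:*_; :-_)

  num : ∀ {n} → ℕ → Polynomial n
  num k = con (+ k)

  :1- :cube :4 :5 : ∀ {n} → Polynomial n → Polynomial n
  :1- x = num 1 :+ :- x
  :cube x = x :* x :* x
  :4 x = x :* x :* x :* x
  :5 x = x :* x :* x :* x :* x

-- The substitution q ↦ q³ and sections modulo 3.

module Dissection where
  open FormalPowerSeries

  open SetoidReasoning setoid

  -- 3n in successor form, which reduces in step with the recursion of `stretch` over three indices
  -- at a time.
  thrice : ℕ → ℕ
  thrice zero    = zero
  thrice (suc n) = suc (suc (suc (thrice n)))

  opaque
    stretch : PowerSeries → PowerSeries
    stretch f zero                = f 0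
    stretch f (suc zero)          = 0ℤ
    stretch f (suc (suc zero))    = 0ℤ
    stretch f (suc (suc (suc n))) = stretch (f ∘ suc) n

    section : Fin 3 → PowerSeries → PowerSeries
    section r f n = f (toℕ r ℕ.+ thrice n)

  opaque
    unfolding _+_ stretch

    section-coeff : ∀ r f n → section r f n ≡ f (toℕ r ℕ.+ thrice n)
    section-coeff r f n = refl

    section-cong : ∀ r {f g} → f ≈ g → section r f ≈ section r g
    section-cong r f≈g = pointwise λ n → coeff f≈g (toℕ r ℕ.+ thrice n)

    section-+ : ∀ r f g → section r (f + g) ≈ section r f + section r g
    section-+ r f g = pointwise λ n → refl

    section-neg : ∀ r f → section r (- f) ≈ - section r f
    section-neg r f = pointwise λ n → refl

    -- A factor q permutes the residue classes cyclically; the passage from class 2 to class 0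
    -- carries a q.
    section-q*₀ : ∀ f → section 0F (q * f) ≈ q * section 2F f
    section-q*₀ f = pointwise λ
      { zero → refl
      ; (suc n) → ≡.trans (q-*-suc f (2 ℕ.+ thrice n)) (≡.sym (q-*-suc (section 2F f) n)) }

    section-q*₁ : ∀ f → section 1F (q * f) ≈ section 0F f
    section-q*₁ f = pointwise λ n → q-*-suc f (thrice n)

    section-q*₂ : ∀ f → section 2F (q * f) ≈ section 1F f
    section-q*₂ f = pointwise λ n → q-*-suc f (suc (thrice n))

    private
      stretch-*-step : ∀ g f n →
        (stretch g * f) (3 ℕ.+ n) ≡ g 0 ℤ.* f (3 ℕ.+ n) ℤ.+ (stretch (g ∘ suc) * f) n
      stretch-*-step g f n = cong (λ x → g 0 ℤ.* f (3 ℕ.+ n) ℤ.+ x)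
        (≡.trans (ℤ.+-identityˡ _) (ℤ.+-identityˡ _))

      section-stretch-*-coeff : ∀ r g f n → section r (stretch g * f) n ≡ (g * section r f) n
      section-stretch-*-coeff 0F g f zero = refl
      section-stretch-*-coeff 1F g f zero = ℤ.+-identityʳ _
      section-stretch-*-coeff 2F g f zero = ℤ.+-identityʳ _
      section-stretch-*-coeff 0F g f (suc n) = ≡.trans (stretch-*-step g f _)
        (cong (λ x → g 0 ℤ.* f (3 ℕ.+ thrice n) ℤ.+ x) (section-stretch-*-coeff 0F (g ∘ suc) f n))
      section-stretch-*-coeff 1F g f (suc n) = ≡.trans (stretch-*-step g f _)
        (cong (λ x → g 0 ℤ.* f (4 ℕ.+ thrice n) ℤ.+ x) (section-stretch-*-coeff 1F (g ∘ suc) f n))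
      section-stretch-*-coeff 2F g f (suc n) = ≡.trans (stretch-*-step g f _)
        (cong (λ x → g 0 ℤ.* f (5 ℕ.+ thrice n) ℤ.+ x) (section-stretch-*-coeff 2F (g ∘ suc) f n))

    -- A factor that is a series in q³ leaves every exponent in its residue class, so sections are
    -- linear over stretched series.
    section-stretch-* : ∀ r g f → section r (stretch g * f) ≈ g * section r f
    section-stretch-* r g f = pointwise (section-stretch-*-coeff r g f)

    section-const-* : ∀ r c f → section r (const c * f) ≈ const c * section r f
    section-const-* r c f = pointwise λ n →
      ≡.trans (const-*-coeff c f (toℕ r ℕ.+ thrice n)) (≡.sym (const-*-coeff c (section r f) n))

    section-stretch₀ : ∀ f → section 0F (stretch f) ≈ f
    section-stretch₀ f = pointwise (go f)
      where
      go : ∀ f n → stretch f (thrice n) ≡ f n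
      go f zero    = refl
      go f (suc n) = go (f ∘ suc) n

    section-stretch₁ : ∀ f → section 1F (stretch f) ≈ 0s
    section-stretch₁ f = pointwise (go f)
      where
      go : ∀ f n → stretch f (1 ℕ.+ thrice n) ≡ 0s n
      go f zero          = refl
      go f (suc zero)    = refl
      go f (suc (suc n)) = go (f ∘ suc) (suc n)

    section-stretch₂ : ∀ f → section 2F (stretch f) ≈ 0s
    section-stretch₂ f = pointwise (go f)
      where
      go : ∀ f n → stretch f (2 ℕ.+ thrice n) ≡ 0s n
      go f zero          = refl
      go f (suc zero)    = refl
      go f (suc (suc n)) = go (f ∘ suc) (suc n)

    stretch-cong : ∀ {f g} → f ≈ g → stretch f ≈ stretch g
    stretch-cong f≈g = pointwise (go f≈g)
      where
      go : ∀ {f g} → f ≈ g → ∀ n → stretch f n ≡ stretch g n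
      go p zero                = coeff p 0
      go p (suc zero)          = refl
      go p (suc (suc zero))    = refl
      go p (suc (suc (suc n))) = go (pointwise (coeff p ∘ suc)) n

    section-injective : ∀ {f g} → (∀ r → section r f ≈ section r g) → f ≈ g
    section-injective {f} {g} p = pointwise (go {f} {g} (λ r → coeff (p r)))
      where
      go : ∀ {f g : PowerSeries} → (∀ r n → f (toℕ {3} r ℕ.+ thrice n) ≡ g (toℕ r ℕ.+ thrice n)) →
           ∀ n → f n ≡ g n
      go p zero                = p 0F 0
      go p (suc zero)          = p 1F 0
      go p (suc (suc zero))    = p 2F 0
      go {f} {g} p (suc (suc (suc n))) = go {λ i → f (3 ℕ.+ i)} {λ i → g (3 ℕ.+ i)}
        (λ { 0F n → p 0F (suc n) ; 1F n → p 1F (suc n) ; 2F n → p 2F (suc n) }) n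

    q-*-injective : ∀ {f g} → q * f ≈ q * g → f ≈ g
    q-*-injective {f} {g} p = pointwise λ n →
      ≡.trans (≡.sym (q-*-suc f n)) (≡.trans (coeff p (suc n)) (q-*-suc g n))

  opaque
    unfolding const section

    section-const₀ : ∀ c → section 0F (const c) ≈ const c
    section-const₀ c = pointwise λ { zero → refl ; (suc n) → refl }

    section-const₁ : ∀ c → section 1F (const c) ≈ 0s
    section-const₁ c = pointwise λ { zero → refl ; (suc n) → refl }

    section-const₂ : ∀ c → section 2F (const c) ≈ 0s
    section-const₂ c = pointwise λ { zero → refl ; (suc n) → refl }

  -- A series supported on multiples of 3 is recognised by its sections; the homomorphism laws of
  -- `stretch` thereby become section computations.
  stretch-≈ : ∀ {f g} → section 0F g ≈ f → section 1F g ≈ 0s → section 2F g ≈ 0s → stretch f ≈ g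
  stretch-≈ {f} p₀ p₁ p₂ = section-injective λ
    { 0F → ≈-trans (section-stretch₀ f) (≈-sym p₀)
    ; 1F → ≈-trans (section-stretch₁ f) (≈-sym p₁)
    ; 2F → ≈-trans (section-stretch₂ f) (≈-sym p₂) }

  stretch-const : ∀ c → stretch (const c) ≈ const c
  stretch-const c = stretch-≈ (section-const₀ c) (section-const₁ c) (section-const₂ c)

  stretch-+ : ∀ f g → stretch (f + g) ≈ stretch f + stretch g
  stretch-+ f g = stretch-≈
    (≈-trans (section-+ 0F _ _) (+-cong (section-stretch₀ f) (section-stretch₀ g)))
    (≈-trans (section-+ 1F _ _) (≈-trans (+-cong (section-stretch₁ f) (section-stretch₁ g)) (+-identityˡ 0s)))
    (≈-trans (section-+ 2F _ _) (≈-trans (+-cong (section-stretch₂ f) (section-stretch₂ g)) (+-identityˡ 0s)))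

  stretch-* : ∀ f g → stretch (f * g) ≈ stretch f * stretch g
  stretch-* f g = stretch-≈
    (≈-trans (section-stretch-* 0F f _) (*-cong ≈-refl (section-stretch₀ g)))
    (≈-trans (section-stretch-* 1F f _) (≈-trans (*-cong ≈-refl (section-stretch₁ g)) (zeroʳ f)))
    (≈-trans (section-stretch-* 2F f _) (≈-trans (*-cong ≈-refl (section-stretch₂ g)) (zeroʳ f)))

  stretch-neg : ∀ f → stretch (- f) ≈ - stretch f
  stretch-neg f = stretch-≈
    (≈-trans (section-neg 0F _) (-‿cong (section-stretch₀ f)))
    (≈-trans (section-neg 1F _) (≈-trans (-‿cong (section-stretch₁ f)) -0≈0))
    (≈-trans (section-neg 2F _) (≈-trans (-‿cong (section-stretch₂ f)) -0≈0))
    where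
    -0≈0 : - 0s ≈ 0s
    -0≈0 = ≈-sym (const-neg 0ℤ)

  stretch-const-* : ∀ k f → stretch (const k * f) ≈ const k * stretch f
  stretch-const-* k f = ≈-trans (stretch-* _ _) (*-cong (stretch-const k) ≈-refl)

  stretch-cube : ∀ f → stretch (cube f) ≈ cube (stretch f)
  stretch-cube f = ≈-trans (stretch-* _ _) (*-cong (stretch-* _ _) ≈-refl)

  stretch-pow4 : ∀ f → stretch (pow4 f) ≈ pow4 (stretch f)
  stretch-pow4 f = ≈-trans (stretch-* _ _) (*-cong (stretch-cube f) ≈-refl)

  stretch-pow5 : ∀ f → stretch (pow5 f) ≈ pow5 (stretch f)
  stretch-pow5 f = ≈-trans (stretch-* _ _) (*-cong (stretch-pow4 f) ≈-refl)

  stretch-q : stretch q ≈ q * (q * q)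
  stretch-q = stretch-≈ {q}
    (begin
      section 0F (q * (q * q)) ≈⟨ section-q*₀ _ ⟩
      q * section 2F (q * q)   ≈⟨ *-cong ≈-refl (section-q*₂ _) ⟩
      q * section 1F q         ≈⟨ *-cong ≈-refl (section-cong 1F q≈q*1) ⟩
      q * section 1F (q * 1s)  ≈⟨ *-cong ≈-refl (≈-trans (section-q*₁ _) (section-const₀ _)) ⟩
      q * 1s                   ≈⟨ *-identityʳ q ⟩
      q ∎)
    (begin
      section 1F (q * (q * q)) ≈⟨ section-q*₁ _ ⟩
      section 0F (q * q)       ≈⟨ section-q*₀ _ ⟩
      q * section 2F q         ≈⟨ *-cong ≈-refl (section-cong 2F q≈q*1) ⟩
      q * section 2F (q * 1s)  ≈⟨ *-cong ≈-refl (≈-trans (section-q*₂ _) (section-const₁ _)) ⟩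
      q * 0s                   ≈⟨ zeroʳ q ⟩
      0s ∎)
    (begin
      section 2F (q * (q * q)) ≈⟨ section-q*₂ _ ⟩
      section 1F (q * q)       ≈⟨ section-q*₁ _ ⟩
      section 0F q             ≈⟨ section-cong 0F q≈q*1 ⟩
      section 0F (q * 1s)      ≈⟨ ≈-trans (section-q*₀ _) (*-cong ≈-refl (section-const₂ _)) ⟩
      q * 0s                   ≈⟨ zeroʳ q ⟩
      0s ∎)
    where
    q≈q*1 : q ≈ q * 1s
    q≈q*1 = ≈-sym (*-identityʳ q)

  stretch-^ : ∀ f n → stretch (f ^ n) ≈ stretch f ^ n
  stretch-^ f zero    = stretch-const 1ℤ
  stretch-^ f (suc n) = ≈-trans (stretch-* f (f ^ n)) (*-cong ≈-refl (stretch-^ f n))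

  dissection : PowerSeries → PowerSeries → PowerSeries → PowerSeries
  dissection a b c = stretch a + q * stretch b + q * (q * stretch c)

  dissection-cong : ∀ {f g h f′ g′ h′} → f ≈ f′ → g ≈ g′ → h ≈ h′ → dissection f g h ≈ dissection f′ g′ h′
  dissection-cong p r s = +-cong (+-cong (stretch-cong p) (*-cong ≈-refl (stretch-cong r))) (*-cong ≈-refl (*-cong ≈-refl (stretch-cong s)))

  section-dissection₀ : ∀ a b c → section 0F (dissection a b c) ≈ a
  section-dissection₀ a b c = begin
    section 0F (dissection a b c)
      ≈⟨ ≈-trans (section-+ 0F _ _) (+-cong (section-+ 0F _ _) (section-q*₀ _)) ⟩
    section 0F (stretch a) + section 0F (q * stretch b) + q * section 2F (q * stretch c)
      ≈⟨ +-cong (+-cong (section-stretch₀ a) (≈-trans (section-q*₀ _) (*-cong ≈-refl (section-stretch₂ b))))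
                (*-cong ≈-refl (≈-trans (section-q*₂ _) (section-stretch₁ c))) ⟩
    a + q * 0s + q * 0s
      ≈⟨ solve 2 (λ q a → a :+ q :* num 0 :+ q :* num 0 := a) ≈-refl q a ⟩
    a ∎

  section-dissection₁ : ∀ a b c → section 1F (dissection a b c) ≈ b
  section-dissection₁ a b c = begin
    section 1F (dissection a b c)
      ≈⟨ ≈-trans (section-+ 1F _ _) (+-cong (section-+ 1F _ _) (section-q*₁ _)) ⟩
    section 1F (stretch a) + section 1F (q * stretch b) + section 0F (q * stretch c)
      ≈⟨ +-cong (+-cong (section-stretch₁ a) (≈-trans (section-q*₁ _) (section-stretch₀ b)))
                (≈-trans (section-q*₀ _) (*-cong ≈-refl (section-stretch₂ c))) ⟩
    0s + b + q * 0s
      ≈⟨ solve 2 (λ q b → num 0 :+ b :+ q :* num 0 := b) ≈-refl q b ⟩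
    b ∎

  section-dissection₂ : ∀ a b c → section 2F (dissection a b c) ≈ c
  section-dissection₂ a b c = begin
    section 2F (dissection a b c)
      ≈⟨ ≈-trans (section-+ 2F _ _) (+-cong (section-+ 2F _ _) (section-q*₂ _)) ⟩
    section 2F (stretch a) + section 2F (q * stretch b) + section 1F (q * stretch c)
      ≈⟨ +-cong (+-cong (section-stretch₂ a) (≈-trans (section-q*₂ _) (section-stretch₁ b)))
                (≈-trans (section-q*₁ _) (section-stretch₀ c)) ⟩
    0s + 0s + c
      ≈⟨ solve 1 (λ c → num 0 :+ num 0 :+ c := c) ≈-refl c ⟩
    c ∎

  dissect : ∀ f → f ≈ dissection (section 0F f) (section 1F f) (section 2F f)
  dissect f = section-injective λ
    { 0F → ≈-sym (section-dissection₀ _ _ _)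
    ; 1F → ≈-sym (section-dissection₁ _ _ _)
    ; 2F → ≈-sym (section-dissection₂ _ _ _) }

-- Congruence modulo powers of q.

module Truncation where
  open FormalPowerSeries
  open Dissection

  infix 4 _≈[_]_
  record _≈[_]_ (f : PowerSeries) (n : ℕ) (g : PowerSeries) : Set where
    constructor below
    field coeff-below : ∀ i → i ℕ.< n → f i ≡ g i
  open _≈[_]_ public

  ≈⇒≈[] : ∀ {n f g} → f ≈ g → f ≈[ n ] g
  ≈⇒≈[] p = below λ i _ → coeff p i

  ≈[]⇒≈ : ∀ {f g} → (∀ n → f ≈[ n ] g) → f ≈ g
  ≈[]⇒≈ p = pointwise λ n → coeff-below (p (suc n)) n (ℕ.n<1+n n)

  ≈[]-mono : ∀ {m n f g} → m ℕ.≤ n → f ≈[ n ] g → f ≈[ m ] g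
  ≈[]-mono m≤n p = below λ i i<m → coeff-below p i (ℕ.<-≤-trans i<m m≤n)

  truncSetoid : ℕ → Setoid 0ℓ 0ℓ
  truncSetoid n = record
    { Carrier = PowerSeries ; _≈_ = _≈[ n ]_
    ; isEquivalence = record
      { refl  = below λ _ _ → refl
      ; sym   = λ p → below λ i i<n → ≡.sym (coeff-below p i i<n)
      ; trans = λ p r → below λ i i<n → ≡.trans (coeff-below p i i<n) (coeff-below r i i<n) } }

  module _ {n : ℕ} where
    open Setoid (truncSetoid n) public using ()
      renaming (refl to ≈[]-refl; sym to ≈[]-sym; trans to ≈[]-trans)

  opaque
    unfolding _+_ stretch

    +-cong[] : ∀ {n f f′ g g′} → f ≈[ n ] f′ → g ≈[ n ] g′ → f + g ≈[ n ] f′ + g′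
    +-cong[] p r = below λ i i<n → cong₂ ℤ._+_ (coeff-below p i i<n) (coeff-below r i i<n)

    -‿cong[] : ∀ {n f f′} → f ≈[ n ] f′ → - f ≈[ n ] - f′
    -‿cong[] p = below λ i i<n → cong ℤ.-_ (coeff-below p i i<n)

    *-cong[] : ∀ {n f f′ g g′} → f ≈[ n ] f′ → g ≈[ n ] g′ → f * g ≈[ n ] f′ * g′
    *-cong[] p r = below λ i i<n → *-cong-below i
      (λ j j≤i → coeff-below p j (ℕ.≤-<-trans j≤i i<n))
      (λ j j≤i → coeff-below r j (ℕ.≤-<-trans j≤i i<n))

    q-*-trunc : ∀ {n f g} → f ≈[ n ] g → q * f ≈[ suc n ] q * g
    q-*-trunc {f = f} {g} p = below λ
      { zero _ → refl
      ; (suc i) (s≤s i<n) → ≡.trans (q-*-suc f i) (≡.trans (coeff-below p i i<n) (≡.sym (q-*-suc g i))) }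

    stretch-cong[] : ∀ {n f g} → f ≈[ n ] g → stretch f ≈[ n ] stretch g
    stretch-cong[] p = below (go p)
      where
      go : ∀ {n f g} → f ≈[ n ] g → ∀ i → i ℕ.< n → stretch f i ≡ stretch g i
      go p zero i<n                            = coeff-below p 0 i<n
      go p (suc zero) i<n                      = refl
      go p (suc (suc zero)) i<n                = refl
      go {f = f} {g} p (suc (suc (suc i))) (s≤s i<n) = go {f = f ∘ suc} {g ∘ suc}
        (below λ j j<n → coeff-below p (suc j) (s≤s j<n)) i
        (ℕ.≤-trans (ℕ.s≤s (ℕ.≤-trans (ℕ.n≤1+n i) (ℕ.n≤1+n _))) i<n)

    -- A section costs a factor 3 of precision: its coefficient i < n is the coefficient r + 3i < 3n
    -- of the series.
    section-cong[] : ∀ {n f g} r → f ≈[ thrice n ] g → section r f ≈[ n ] section r g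
    section-cong[] {n} r p = below λ i i<n → coeff-below p (toℕ r ℕ.+ thrice i) (r+3i<3n r i<n)
      where
      mono : ∀ {i n} → i ℕ.≤ n → thrice i ℕ.≤ thrice n
      mono z≤n     = z≤n
      mono (s≤s p) = s≤s (s≤s (s≤s (mono p)))
      r+3i<3n : ∀ r {i n} → i ℕ.< n → toℕ {3} r ℕ.+ thrice i ℕ.< thrice n
      r+3i<3n r {i} (s≤s {n = n} i≤n) with toℕ r | toℕ<n r
      ... | k | s≤s k≤2 = s≤s (ℕ.+-mono-≤ k≤2 (mono i≤n))

  -- The only source of additional precision; it recovers what is lost when a quotient of products
  -- is known only modulo a small power of q.
  q^-*-trunc : ∀ k {n f g} → f ≈[ n ] g → q ^ k * f ≈[ k ℕ.+ n ] q ^ k * g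
  q^-*-trunc zero    p = *-cong[] (≈[]-refl {x = q ^ 0}) p
  q^-*-trunc (suc k) p =
    ≈[]-trans (≈⇒≈[] (*-assoc q (q ^ k) _))
      (≈[]-trans (q-*-trunc (q^-*-trunc k p)) (≈⇒≈[] (≈-sym (*-assoc q (q ^ k) _))))

-- Partial products, their inverses, and (q;q)_∞.

module EulerProduct where
  open FormalPowerSeries
  open Dissection
  open Truncation

  sum-applyUpTo-zero : ∀ g n → (∀ j → g j ≡ 0) → sum (applyUpTo g n) ≡ 0
  sum-applyUpTo-zero g zero    g≡0 = refl
  sum-applyUpTo-zero g (suc n) g≡0 = cong₂ ℕ._+_ (g≡0 0) (sum-applyUpTo-zero (g ∘ suc) n (g≡0 ∘ suc))

  sum-applyUpTo-cong : ∀ {g h} n → (∀ j → g j ≡ h j) → sum (applyUpTo g n) ≡ sum (applyUpTo h n)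
  sum-applyUpTo-cong zero    g≡h = refl
  sum-applyUpTo-cong (suc n) g≡h = cong₂ ℕ._+_ (g≡h 0) (sum-applyUpTo-cong n (g≡h ∘ suc))

  sum-applyUpTo-+ : ∀ g m n → (∀ j → m ℕ.≤ j → g j ≡ 0) →
    sum (applyUpTo g (m ℕ.+ n)) ≡ sum (applyUpTo g m)
  sum-applyUpTo-+ g zero    n g≡0 = sum-applyUpTo-zero g n (λ j → g≡0 j z≤n)
  sum-applyUpTo-+ g (suc m) n g≡0 =
    cong (g 0 ℕ.+_) (sum-applyUpTo-+ (g ∘ suc) m n (λ j m≤j → g≡0 (suc j) (s≤s m≤j)))

  private
    term : ℕ → Series → ℕ → ℕ → ℕ
    term k f n j = if j ℕ.* k ≤ᵇ n then f (n ∸ j ℕ.* k) else 0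

    ≤ᵇ-false : ∀ m n → n ℕ.< m → (m ≤ᵇ n) ≡ false
    ≤ᵇ-false m n n<m with m ≤ᵇ n in eq
    ... | false = refl
    ... | true  = contradiction (ℕ.≤ᵇ⇒≤ m n (≡.subst (λ b → T b) (≡.sym eq) _)) (ℕ.<⇒≱ n<m)

    ≤ᵇ-+ : ∀ k a b → (k ℕ.+ a ≤ᵇ k ℕ.+ b) ≡ (a ≤ᵇ b)
    ≤ᵇ-+ zero    a b = refl
    ≤ᵇ-+ (suc k) a b = ≡.trans (lem (k ℕ.+ a) (k ℕ.+ b)) (≤ᵇ-+ k a b)
      where
      lem : ∀ a b → (suc a ≤ᵇ suc b) ≡ (a ≤ᵇ b)
      lem zero    b = refl
      lem (suc a) b = refl

    term-zero : ∀ k f n j → n ℕ.< j ℕ.* k → term k f n j ≡ 0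
    term-zero k f n j n<jk rewrite ≤ᵇ-false (j ℕ.* k) n n<jk = refl

    term-suc : ∀ k f n j → term k f (k ℕ.+ n) (suc j) ≡ term k f n j
    term-suc k f n j rewrite ≤ᵇ-+ k (j ℕ.* k) n | ℕ.[m+n]∸[m+o]≡n∸o k n (j ℕ.* k) = refl

    divOneMinus-sum : ∀ k f n → divOneMinus k f n ≡ f n ℕ.+ sum (applyUpTo (term k f n ∘ suc) n)
    divOneMinus-sum k f n = cong sum (map-upTo (term k f n) (suc n))

  divOneMinus-< : ∀ k f n → n ℕ.< k → divOneMinus k f n ≡ f n
  divOneMinus-< k f n n<k = ≡.trans (divOneMinus-sum k f n)
    (≡.trans (cong (f n ℕ.+_) (sum-applyUpTo-zero (term k f n ∘ suc) n
       (λ j → term-zero k f n (suc j) (ℕ.<-≤-trans n<k (ℕ.m≤m+n k (j ℕ.* k))))))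
     (ℕ.+-identityʳ (f n)))

  divOneMinus-+ : ∀ k f n → divOneMinus (suc k) f (suc k ℕ.+ n) ≡ f (suc k ℕ.+ n) ℕ.+ divOneMinus (suc k) f n
  divOneMinus-+ k f n = ≡.trans (divOneMinus-sum (suc k) f (suc k ℕ.+ n)) (cong (f (suc k ℕ.+ n) ℕ.+_) (begin
    sum (applyUpTo (term (suc k) f (suc k ℕ.+ n) ∘ suc) (suc k ℕ.+ n))
      ≡⟨ sum-applyUpTo-cong (suc k ℕ.+ n) (term-suc (suc k) f n) ⟩
    sum (applyUpTo (term (suc k) f n) (suc k ℕ.+ n))
      ≡⟨ cong (sum ∘ applyUpTo (term (suc k) f n) ∘ suc) (ℕ.+-comm k n) ⟩
    sum (applyUpTo (term (suc k) f n) (suc n ℕ.+ k))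
      ≡⟨ sum-applyUpTo-+ (term (suc k) f n) (suc n) k
           (λ j n<j → term-zero (suc k) f n j (ℕ.<-≤-trans n<j (ℕ.m≤m*n j (suc k)))) ⟩
    sum (applyUpTo (term (suc k) f n) (suc n))
      ≡⟨ cong sum (map-upTo (term (suc k) f n) (suc n)) ⟨
    divOneMinus (suc k) f n ∎))
    where open ≡.≡-Reasoning

  fromℕSeries : Series → PowerSeries
  fromℕSeries f n = + f n

  q^-*-coeff-< : ∀ k f n → n ℕ.< k → (q ^ k * f) n ≡ 0ℤ
  q^-*-coeff-< (suc k) f zero n<k = ≡.trans (coeff (*-assoc q (q ^ k) f) 0) (q-*-zero _)
  q^-*-coeff-< (suc k) f (suc n) (s≤s n<k) = ≡.trans (coeff (*-assoc q (q ^ k) f) (suc n))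
    (≡.trans (q-*-suc _ n) (q^-*-coeff-< k f n n<k))

  q^-*-coeff-+ : ∀ k f n → (q ^ k * f) (k ℕ.+ n) ≡ f n
  q^-*-coeff-+ zero    f n = coeff (*-identityˡ f) n
  q^-*-coeff-+ (suc k) f n = ≡.trans (coeff (*-assoc q (q ^ k) f) (suc (k ℕ.+ n)))
    (≡.trans (q-*-suc _ (k ℕ.+ n)) (q^-*-coeff-+ k f n))

  opaque
    unfolding _+_
    divOneMinus-+-q^* : ∀ k f →
      fromℕSeries (divOneMinus (suc k) f) ≈ fromℕSeries f + q ^ suc k * fromℕSeries (divOneMinus (suc k) f)
    divOneMinus-+-q^* k f = pointwise go
      where
      go : ∀ n → + divOneMinus (suc k) f n ≡ + f n ℤ.+ (q ^ suc k * fromℕSeries (divOneMinus (suc k) f)) n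
      go n with n ℕ.<? suc k
      ... | yes n<k = ≡.trans (cong +_ (divOneMinus-< (suc k) f n n<k))
        (≡.trans (≡.sym (ℤ.+-identityʳ (+ f n))) (cong (λ x → + f n ℤ.+ x) (≡.sym (q^-*-coeff-< (suc k) _ n n<k))))
      ... | no n≮k with ℕ.m≤n⇒∃[o]m+o≡n (ℕ.≮⇒≥ n≮k)
      ...   | m , refl = ≡.trans (cong +_ (divOneMinus-+ k f m))
        (cong (λ x → + f (suc k ℕ.+ m) ℤ.+ x) (≡.sym (q^-*-coeff-+ (suc k) _ m)))

    fromℕSeries-one : fromℕSeries one ≈ 1s
    fromℕSeries-one = pointwise λ { zero → refl ; (suc n) → refl }

  1-q^-*-divOneMinus : ∀ k f → 1- q ^ suc k * fromℕSeries (divOneMinus (suc k) f) ≈ fromℕSeries f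
  1-q^-*-divOneMinus k f = begin
    1- q ^ suc k * h                     ≈⟨ solve 2 (λ x h → (num 1 :+ :- x) :* h := h :+ :- (x :* h)) ≈-refl (q ^ suc k) h ⟩
    h + - (q ^ suc k * h)                ≈⟨ +-cong (divOneMinus-+-q^* k f) ≈-refl ⟩
    f′ + q ^ suc k * h + - (q ^ suc k * h) ≈⟨ solve 2 (λ x y → x :+ y :+ :- y := x) ≈-refl f′ (q ^ suc k * h) ⟩
    f′                                   ∎
    where
    open SetoidReasoning setoid
    h = fromℕSeries (divOneMinus (suc k) f)
    f′ = fromℕSeries f

  poch : PowerSeries → ℕ → PowerSeries
  poch x zero    = 1s
  poch x (suc m) = 1- x ^ suc m * poch x m

  poch-*-divPoch : ∀ s m f → poch (q ^ suc s) m * fromℕSeries (divPoch (suc s) m f) ≈ fromℕSeries f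
  poch-*-divPoch s zero    f = *-identityˡ _
  poch-*-divPoch s (suc m) f = begin
    1- (q ^ suc s) ^ suc m * poch (q ^ suc s) m * h
      ≈⟨ solve 3 (λ a b c → a :* b :* c := b :* (a :* c)) ≈-refl _ _ _ ⟩
    poch (q ^ suc s) m * (1- (q ^ suc s) ^ suc m * h)
      ≈⟨ *-cong ≈-refl (*-cong (+-cong ≈-refl (-‿cong (^-assocʳ q (suc s) (suc m)))) ≈-refl) ⟩
    poch (q ^ suc s) m * (1- q ^ (suc s ℕ.* suc m) * h)
      ≈⟨ *-cong ≈-refl (1-q^-*-divOneMinus _ (divPoch (suc s) m f)) ⟩
    poch (q ^ suc s) m * fromℕSeries (divPoch (suc s) m f)
      ≈⟨ poch-*-divPoch s m f ⟩
    fromℕSeries f ∎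
    where
    open SetoidReasoning setoid
    h = fromℕSeries (divPoch (suc s) (suc m) f)

  poch-cong : ∀ {x y} m → x ≈ y → poch x m ≈ poch y m
  poch-cong zero    x≈y = ≈-refl
  poch-cong (suc m) x≈y = *-cong (+-cong ≈-refl (-‿cong (^-congˡ (suc m) x≈y))) (poch-cong m x≈y)

  stretch-1- : ∀ f → stretch (1- f) ≈ 1- stretch f
  stretch-1- f = ≈-trans (stretch-+ 1s (- f)) (+-cong (stretch-const 1ℤ) (stretch-neg f))

  stretch-poch : ∀ x m → stretch (poch x m) ≈ poch (stretch x) m
  stretch-poch x zero    = stretch-const 1ℤ
  stretch-poch x (suc m) = ≈-trans (stretch-* _ _)
    (*-cong (≈-trans (stretch-1- _) (+-cong ≈-refl (-‿cong (stretch-^ x (suc m))))) (stretch-poch x m))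

  P : ℕ → PowerSeries
  P = poch q

  1/P : ℕ → PowerSeries
  1/P m = fromℕSeries (divPoch 1 m one)

  P-*-1/P : ∀ m → P m * 1/P m ≈ 1s
  P-*-1/P m = ≈-trans (*-cong (poch-cong m (≈-sym (*-identityʳ q))) ≈-refl)
    (≈-trans (poch-*-divPoch 0 m one) fromℕSeries-one)

  q^-trunc : ∀ k f → q ^ k * f ≈[ k ] const 0ℤ
  q^-trunc k f = below λ n n<k → ≡.trans (q^-*-coeff-< k f n n<k) (≡.sym (lem n))
    where
    opaque
      unfolding const
      lem : ∀ n → const 0ℤ n ≡ 0ℤ
      lem zero = refl
      lem (suc n) = refl

  P-suc-trunc : ∀ m → P (suc m) ≈[ suc m ] P m
  P-suc-trunc m = begin
    1- q ^ suc m * P m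
      ≈⟨ ≈⇒≈[] (solve 2 (λ x y → (num 1 :+ :- x) :* y := y :+ :- (x :* y)) ≈-refl (q ^ suc m) (P m)) ⟩
    P m + - (q ^ suc m * P m)
      ≈⟨ +-cong[] ≈[]-refl (-‿cong[] (q^-trunc (suc m) (P m))) ⟩
    P m + - const 0ℤ
      ≈⟨ ≈⇒≈[] (solve 1 (λ y → y :+ :- num 0 := y) ≈-refl (P m)) ⟩
    P m ∎
    where open SetoidReasoning (truncSetoid (suc m))

  P-trunc : ∀ {m n} → m ℕ.≤ n → P n ≈[ suc m ] P m
  P-trunc m≤n = go (ℕ.≤⇒≤′ m≤n)
    where
    go : ∀ {m n} → m ℕ.≤′ n → P n ≈[ suc m ] P m
    go (ℕ.≤′-reflexive refl) = ≈[]-refl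
    go (ℕ.≤′-step m≤n) = ≈[]-trans (≈[]-mono (s≤s (ℕ.≤′⇒≤ m≤n)) (P-suc-trunc _)) (go m≤n)

  -- Inverses inherit the stability of `P`: insert P m · 1/P m, replace P m by P n up to the
  -- precision, and cancel against 1/P n.
  1/P-trunc : ∀ {m n} → m ℕ.≤ n → 1/P n ≈[ suc m ] 1/P m
  1/P-trunc {m} {n} m≤n = begin
    1/P n                 ≈⟨ ≈⇒≈[] (≈-sym (≈-trans (*-cong ≈-refl (P-*-1/P m)) (*-identityʳ _))) ⟩
    1/P n * (P m * 1/P m) ≈⟨ *-cong[] ≈[]-refl (*-cong[] (≈[]-sym (P-trunc m≤n)) ≈[]-refl) ⟩
    1/P n * (P n * 1/P m) ≈⟨ ≈⇒≈[] (solve 3 (λ a b c → a :* (b :* c) := (b :* a) :* c) ≈-refl _ _ _) ⟩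
    P n * 1/P n * 1/P m   ≈⟨ ≈⇒≈[] (≈-trans (*-cong (P-*-1/P n) ≈-refl) (*-identityˡ _)) ⟩
    1/P m                 ∎
    where open SetoidReasoning (truncSetoid (suc m))

  opaque
    -- Diagonals of the partial products: the coefficient of qⁿ no longer changes after the n-th
    -- product, so no limit has to be formed.
    E 1/E : PowerSeries
    E n = P n n
    1/E n = 1/P n n

    E-trunc : ∀ n → E ≈[ suc n ] P n
    E-trunc n = below λ { i (s≤s i≤n) → ≡.sym (coeff-below (P-trunc i≤n) i (ℕ.n<1+n i)) }

    1/E-trunc : ∀ n → 1/E ≈[ suc n ] 1/P n
    1/E-trunc n = below λ { i (s≤s i≤n) → ≡.sym (coeff-below (1/P-trunc i≤n) i (ℕ.n<1+n i)) }

  E-*-1/E : E * 1/E ≈ 1s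
  E-*-1/E = ≈[]⇒≈ λ n → ≈[]-mono (ℕ.n≤1+n n)
    (≈[]-trans (*-cong[] (E-trunc n) (1/E-trunc n)) (≈⇒≈[] (P-*-1/P n)))

-- The coefficients of the finite Jacobi triple product.

module FiniteTripleProduct where
  open FormalPowerSeries
  open EulerProduct

  -- d n k is the coefficient of zᵏ in (1 − 1/z) Π_{i ≤ n} (1 − z qⁱ)(1 − qⁱ/z).  It is antisymmetric under
  -- k ↦ −1 − k, which is why the left neighbour of d n 0 is − d n 0.
  mutual
    d : ℕ → ℕ → PowerSeries
    d zero    zero    = 1s
    d zero    (suc k) = 0s
    d (suc n) k       =
      (1s + q ^ suc n * q ^ suc n) * d n k + - (q ^ suc n * (d-pred n k + d n (suc k)))

    d-pred : ℕ → ℕ → PowerSeries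
    d-pred n zero    = - d n zero
    d-pred n (suc k) = d n k

  -- (-1)ᵏ q^(k(k+1)/2), with T for triangular number.
  signedQ^T : ℕ → PowerSeries
  signedQ^T zero    = 1s
  signedQ^T (suc k) = - (q ^ suc k * signedQ^T k)

  d-zero : ∀ n k → n ℕ.< k → d n k ≈ 0s
  d-zero zero    (suc k) _         = ≈-refl
  d-zero (suc n) (suc k) (s≤s n<k) = begin
    (1s + Q * Q) * d n (suc k) + - (Q * (d n k + d n (suc (suc k))))
      ≈⟨ +-cong (*-cong ≈-refl (d-zero n (suc k) (ℕ.m<n⇒m<1+n n<k)))
           (-‿cong (*-cong ≈-refl (+-cong (d-zero n k n<k)
             (d-zero n (suc (suc k)) (ℕ.m<n⇒m<1+n (ℕ.m<n⇒m<1+n n<k)))))) ⟩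
    (1s + Q * Q) * 0s + - (Q * (0s + 0s))
      ≈⟨ solve 1 (λ x → (num 1 :+ x :* x) :* num 0 :+ :- (x :* (num 0 :+ num 0)) := num 0) ≈-refl Q ⟩
    0s ∎
    where
    open SetoidReasoning setoid
    Q = q ^ suc n

  q^≡ : ∀ {m n} → m ≡ n → q ^ m ≈ q ^ n
  q^≡ p = ^-congʳ q p

  -- The q-binomial theorem for 2n + 1 linear factors: d n k is (-1)ᵏ q^(k(k+1)/2) times the
  -- Gaussian binomial of 2n + 1 over n - k. Denominators are cleared, and i stands for n - k to
  -- avoid subtraction.
  ClosedForm : ℕ → Set
  ClosedForm n = ∀ i k → i ℕ.+ k ≡ n →
    d n k * (P i * P (suc (n ℕ.+ k))) ≈ signedQ^T k * P (suc (n ℕ.+ n))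

  private
    module Step (n : ℕ) (closedForm : ClosedForm n) where
      open SetoidReasoning setoid

      Z Q : PowerSeries
      Z = P (suc (n ℕ.+ n))
      Q = q ^ suc n

      -- The denominator of the closed form at n + 1. Multiplied by it, each of the three terms of
      -- the recurrence (`centre`, `left`, `right`) becomes a multiple of the same product
      -- `signedQ^T k * Z`.
      L : ℕ → ℕ → PowerSeries
      L i k = P i * P (suc (suc (n ℕ.+ k)))

      centre : ∀ i k → i ℕ.+ k ≡ suc n →
        d n k * L i k ≈ 1- q ^ i * 1- q ^ suc (suc (n ℕ.+ k)) * (signedQ^T k * Z)
      -- Here k = n + 1 is outside the support of `d n`, and the right side vanishes through its
      -- factor 1 - q⁰.
      centre zero k refl = begin
        d n k * L 0 k ≈⟨ *-cong (d-zero n k ℕ.≤-refl) ≈-refl ⟩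
        0s * L 0 k
          ≈⟨ solve 3 (λ l v z → num 0 :* l := :1- (num 1) :* v :* z) ≈-refl (L 0 k) _ _ ⟩
        1- q ^ 0 * 1- q ^ suc (suc (n ℕ.+ k)) * (signedQ^T k * Z) ∎
      centre (suc i) k p = begin
        d n k * (1- q ^ suc i * P i * (1- q ^ suc (suc (n ℕ.+ k)) * P (suc (n ℕ.+ k))))
          ≈⟨ solve 5 (λ a b c e f → a :* (b :* c :* (e :* f)) := b :* e :* (a :* (c :* f))) ≈-refl _ _ _ _ _ ⟩
        1- q ^ suc i * 1- q ^ suc (suc (n ℕ.+ k)) * (d n k * (P i * P (suc (n ℕ.+ k))))
          ≈⟨ *-cong ≈-refl (closedForm i k (ℕ.suc-injective p)) ⟩
        1- q ^ suc i * 1- q ^ suc (suc (n ℕ.+ k)) * (signedQ^T k * Z) ∎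

      left : ∀ i k → i ℕ.+ k ≡ suc n →
        - (Q * d-pred n k) * L i k
          ≈ q ^ i * (1- q ^ suc (n ℕ.+ k) * 1- q ^ suc (suc (n ℕ.+ k))) * (signedQ^T k * Z)
      -- The antisymmetry built into `d-pred` reduces k = 0 to `centre`. In this case i = n + 1, so
      -- q^i = Q and 1 - q^i is also the factor wanted here.
      left i zero p = begin
        - (Q * - d n 0) * L i 0
          ≈⟨ solve 3 (λ x y z → :- (x :* :- y) :* z := x :* (y :* z)) ≈-refl Q (d n 0) (L i 0) ⟩
        Q * (d n 0 * L i 0)
          ≈⟨ *-cong (q^≡ (≡.sym i≡)) (centre i 0 p) ⟩
        q ^ i * (1- q ^ i * 1- q ^ suc (suc (n ℕ.+ 0)) * (1s * Z))
          ≈⟨ *-cong ≈-refl (*-cong (*-cong (+-cong ≈-refl (-‿cong (q^≡ (≡.trans i≡ (cong suc (≡.sym (ℕ.+-identityʳ n))))))) ≈-refl) ≈-refl) ⟩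
        q ^ i * (1- q ^ suc (n ℕ.+ 0) * 1- q ^ suc (suc (n ℕ.+ 0)) * (1s * Z))
          ≈⟨ *-assoc _ _ _ ⟨
        q ^ i * (1- q ^ suc (n ℕ.+ 0) * 1- q ^ suc (suc (n ℕ.+ 0))) * (1s * Z) ∎
        where
        i≡ : i ≡ suc n
        i≡ = ≡.trans (≡.sym (ℕ.+-identityʳ i)) p
      left i (suc k) p = begin
        - (Q * d n k) * (P i * P (suc (suc (n ℕ.+ suc k))))
          ≈⟨ *-cong ≈-refl (*-cong ≈-refl (≈-reflexive (cong (P ∘ suc ∘ suc) (ℕ.+-suc n k)))) ⟩
        - (Q * d n k) * (P i * (1- q ^ suc (suc (suc (n ℕ.+ k))) * (1- q ^ suc (suc (n ℕ.+ k)) * P (suc (n ℕ.+ k)))))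
          ≈⟨ solve 6 (λ x y a b c e → :- (x :* y) :* (a :* (b :* (c :* e))) := :- (x :* (c :* b)) :* (y :* (a :* e))) ≈-refl _ _ _ _ _ _ ⟩
        - (Q * (1- q ^ suc (suc (n ℕ.+ k)) * 1- q ^ suc (suc (suc (n ℕ.+ k))))) * (d n k * (P i * P (suc (n ℕ.+ k))))
          ≈⟨ *-cong (-‿cong (*-cong Q≈ (≈-reflexive (cong (λ m → 1- q ^ suc m * 1- q ^ suc (suc m)) (≡.sym (ℕ.+-suc n k)))))) (closedForm i k p′) ⟩
        - (q ^ i * q ^ suc k * (1- q ^ suc (n ℕ.+ suc k) * 1- q ^ suc (suc (n ℕ.+ suc k)))) * (signedQ^T k * Z)
          ≈⟨ solve 5 (λ a b c e f → :- (a :* b :* c) :* (e :* f) := a :* c :* (:- (b :* e) :* f)) ≈-refl _ _ _ _ _ ⟩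
        q ^ i * (1- q ^ suc (n ℕ.+ suc k) * 1- q ^ suc (suc (n ℕ.+ suc k))) * (signedQ^T (suc k) * Z) ∎
        where
        p′ : i ℕ.+ k ≡ n
        p′ = ℕ.suc-injective (≡.trans (≡.sym (ℕ.+-suc i k)) p)
        Q≈ : Q ≈ q ^ i * q ^ suc k
        Q≈ = ≈-trans (q^≡ (≡.sym p)) (^-homo-* q i (suc k))

      -- The factor q - q^i is q (1 - q^(i-1)) without a subtraction in the exponent. It makes the
      -- right side vanish for i = 1, as 1 - q^i does for i = 0; these are the cases where d n (k +
      -- 1) lies outside the support.
      right : ∀ i k → i ℕ.+ k ≡ suc n →
        - (Q * d n (suc k)) * L i k
          ≈ q ^ i * (q ^ k * q ^ k) * (1- q ^ i * (q + - q ^ i)) * (signedQ^T k * Z)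
      right zero k p = begin
        - (Q * d n (suc k)) * L 0 k
          ≈⟨ *-cong (-‿cong (*-cong ≈-refl (d-zero n (suc k) (ℕ.m≤n⇒m≤1+n (ℕ.≤-reflexive (≡.sym p)))))) ≈-refl ⟩
        - (Q * 0s) * L 0 k
          ≈⟨ solve 5 (λ x l v z q → :- (x :* num 0) :* l := num 1 :* v :* (:1- (num 1) :* (q :+ :- num 1)) :* z) ≈-refl Q (L 0 k) _ _ _ ⟩
        q ^ 0 * (q ^ k * q ^ k) * (1- q ^ 0 * (q + - q ^ 0)) * (signedQ^T k * Z) ∎
      right (suc zero) k p = begin
        - (Q * d n (suc k)) * L 1 k
          ≈⟨ *-cong (-‿cong (*-cong ≈-refl (d-zero n (suc k) (ℕ.≤-reflexive (≡.sym p))))) ≈-refl ⟩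
        - (Q * 0s) * L 1 k
          ≈⟨ solve 5 (λ x l v z q → :- (x :* num 0) :* l := (q :* num 1) :* v :* (:1- (q :* num 1) :* (q :+ :- (q :* num 1))) :* z) ≈-refl Q (L 1 k) _ _ _ ⟩
        q ^ 1 * (q ^ k * q ^ k) * (1- q ^ 1 * (q + - q ^ 1)) * (signedQ^T k * Z) ∎
      right (suc (suc i)) k p = begin
        - (Q * d n (suc k)) * (1- (q * q ^ suc i) * (1- q ^ suc i * P i) * P (suc (suc (n ℕ.+ k))))
          ≈⟨ solve 6 (λ x y a b c e → :- (x :* y) :* (a :* (b :* c) :* e) := :- (x :* (a :* b)) :* (y :* (c :* e))) ≈-refl _ _ _ _ _ _ ⟩
        - (Q * (1- (q * q ^ suc i) * 1- q ^ suc i)) * (d n (suc k) * (P i * P (suc (suc (n ℕ.+ k)))))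
          ≈⟨ *-cong (-‿cong (*-cong Q≈ ≈-refl)) (≈-trans (*-cong ≈-refl (*-cong ≈-refl (≈-reflexive (cong (P ∘ suc) (≡.sym (ℕ.+-suc n k))))))
              (closedForm i (suc k) (≡.trans (ℕ.+-suc i k) (ℕ.suc-injective p)))) ⟩
        - (q * q ^ suc i * q ^ k * (1- (q * q ^ suc i) * 1- q ^ suc i)) * (- (q * q ^ k * signedQ^T k) * Z)
          ≈⟨ solve 5 (λ q u v s z → :- (q :* u :* v :* (:1- (q :* u) :* :1- u)) :* (:- (q :* v :* s) :* z)
                       := q :* u :* (v :* v) :* (:1- (q :* u) :* (q :+ :- (q :* u))) :* (s :* z)) ≈-refl q (q ^ suc i) (q ^ k) _ _ ⟩
        q ^ suc (suc i) * (q ^ k * q ^ k) * (1- q ^ suc (suc i) * (q + - q ^ suc (suc i))) * (signedQ^T k * Z) ∎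
        where
        Q≈ : Q ≈ q ^ suc (suc i) * q ^ k
        Q≈ = ≈-trans (q^≡ (≡.sym p)) (^-homo-* q (suc (suc i)) k)

      step : ClosedForm (suc n)
      step i k p = begin
        d (suc n) k * L i k
          ≈⟨ solve 5 (λ Q a b c l → ((num 1 :+ Q :* Q) :* a :+ :- (Q :* (b :+ c))) :* l
                       := (num 1 :+ Q :* Q) :* (a :* l) :+ :- (Q :* b) :* l :+ :- (Q :* c) :* l) ≈-refl _ _ _ _ _ ⟩
        (1s + Q * Q) * (d n k * L i k) + - (Q * d-pred n k) * L i k + - (Q * d n (suc k)) * L i k
          ≈⟨ +-cong (+-cong (*-cong ≈-refl (centre i k p)) (left i k p)) (right i k p) ⟩
        (1s + Q * Q) * (1- u * 1- X₂ * Y) + u * (1- X₁ * 1- X₂) * Y + u * (v * v) * (1- u * (q + - u)) * Y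
          ≈⟨ +-cong (+-cong (*-cong (+-cong ≈-refl (*-cong Q≈ Q≈)) (*-cong (*-cong ≈-refl 1-X₂≈) ≈-refl))
               (*-cong (*-cong ≈-refl (*-cong (1-cong X₁≈) 1-X₂≈)) ≈-refl)) ≈-refl ⟩
        (1s + u * v * (u * v)) * (1- u * 1- (q * (u * v * v)) * Y) + u * (1- (u * v * v) * 1- (q * (u * v * v))) * Y
          + u * (v * v) * (1- u * (q + - u)) * Y
          -- Since n + 1 = i + k, every power of q that occurs is a monomial in q, u and v, and the
          -- recurrence has become a polynomial identity.
          ≈⟨ solve 5 (λ q u v s z →
               (num 1 :+ u :* v :* (u :* v)) :* (:1- u :* :1- (q :* (u :* v :* v)) :* (s :* z))
                 :+ u :* (:1- (u :* v :* v) :* :1- (q :* (u :* v :* v))) :* (s :* z)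
                 :+ u :* (v :* v) :* (:1- u :* (q :+ :- u)) :* (s :* z)
               := s :* (:1- (q :* (u :* v :* (u :* v))) :* (:1- (u :* v :* (u :* v)) :* z))) ≈-refl q u v _ _ ⟩
        signedQ^T k * (1- (q * (u * v * (u * v))) * (1- (u * v * (u * v)) * Z))
          ≈⟨ *-cong ≈-refl (*-cong (1-cong (*-cong ≈-refl 2n+2≈)) (*-cong (1-cong 2n+2≈) ≈-refl)) ⟨
        signedQ^T k * P (suc (suc (suc (n ℕ.+ n))))
          ≈⟨ *-cong ≈-refl (≈-reflexive (cong (P ∘ suc ∘ suc) (≡.sym (ℕ.+-suc n n)))) ⟩
        signedQ^T k * P (suc (suc n ℕ.+ suc n)) ∎
        where
        u v X₁ X₂ Y : PowerSeries
        u = q ^ i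
        v = q ^ k
        X₁ = q ^ suc (n ℕ.+ k)
        X₂ = q ^ suc (suc (n ℕ.+ k))
        Y = signedQ^T k * Z
        1-cong : ∀ {x y} → x ≈ y → 1- x ≈ 1- y
        1-cong r = +-cong ≈-refl (-‿cong r)
        Q≈ : Q ≈ u * v
        Q≈ = ≈-trans (q^≡ (≡.sym p)) (^-homo-* q i k)
        X₁≈ : X₁ ≈ u * v * v
        X₁≈ = ≈-trans (^-homo-* q (suc n) k) (*-cong Q≈ ≈-refl)
        1-X₂≈ : 1- X₂ ≈ 1- (q * (u * v * v))
        1-X₂≈ = 1-cong (*-cong ≈-refl X₁≈)
        2n+2≈ : q ^ suc (suc (n ℕ.+ n)) ≈ u * v * (u * v)
        2n+2≈ = ≈-trans (q^≡ (cong suc (≡.sym (ℕ.+-suc n n)))) (≈-trans (^-homo-* q (suc n) (suc n)) (*-cong Q≈ Q≈))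

  closedForm : ∀ n → ClosedForm n
  closedForm zero    zero zero refl = solve 1 (λ x → num 1 :* (num 1 :* x) := num 1 :* x) ≈-refl _
  closedForm (suc n) i k p = Step.step n (closedForm n) i k p

-- Jacobi's identity for (q;q)_∞³ and its sections modulo 3.

module CubeOfEulerProduct where
  open FormalPowerSeries
  open Dissection
  open Truncation
  open EulerProduct
  open FiniteTripleProduct

  odd : ℕ → PowerSeries
  odd zero    = 1s
  odd (suc k) = odd k + const (+ 2)

  weighted : ℕ → (ℕ → PowerSeries) → PowerSeries
  weighted zero    x = 0s
  weighted (suc m) x = weighted m x + odd m * x m

  -- Differentiating the finite triple product at z = 1 turns d n k into (2k + 1) d n k summed over k ≥ 0.
  module _ where
    open SetoidReasoning setoid

    -- Summation by parts: the weight 2k + 1 is affine in k, so (1 + Q²)(2k + 1) - Q((2k - 1) + (2k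
    -- + 3)) = (1 - Q)²(2k + 1). At k = 0 the antisymmetry supplies the weight -1 of the index -1;
    -- the last summand is the boundary term at k = m.
    weighted-d-suc : ∀ n m → let Q = q ^ suc n in
      weighted (suc m) (d (suc n)) ≈
        1- Q * 1- Q * weighted (suc m) (d n) + Q * ((odd m + const (+ 2)) * d n m + - (odd m * d n (suc m)))
    weighted-d-suc n zero =
      solve 3 (λ Q a b → num 0 :+ num 1 :* ((num 1 :+ Q :* Q) :* a :+ :- (Q :* (:- a :+ b)))
        := :1- Q :* :1- Q :* (num 0 :+ num 1 :* a) :+ Q :* ((num 1 :+ num 2) :* a :+ :- (num 1 :* b)))
        ≈-refl (q ^ suc n) (d n 0) (d n 1)
    weighted-d-suc n (suc m) = begin
      weighted (suc m) (d (suc n)) + odd (suc m) * d (suc n) (suc m)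
        ≈⟨ +-cong (weighted-d-suc n m) ≈-refl ⟩
      1- Q * 1- Q * weighted (suc m) (d n) + Q * ((odd m + const (+ 2)) * d n m + - (odd m * d n (suc m)))
        + (odd m + const (+ 2)) * d (suc n) (suc m)
        ≈⟨ solve 6 (λ Q w o a b c →
             :1- Q :* :1- Q :* w :+ Q :* ((o :+ num 2) :* a :+ :- (o :* b))
               :+ (o :+ num 2) :* ((num 1 :+ Q :* Q) :* b :+ :- (Q :* (a :+ c)))
             := :1- Q :* :1- Q :* (w :+ (o :+ num 2) :* b)
               :+ Q :* ((o :+ num 2 :+ num 2) :* b :+ :- ((o :+ num 2) :* c)))
             ≈-refl Q (weighted (suc m) (d n)) (odd m) (d n m) (d n (suc m)) (d n (suc (suc m))) ⟩
      1- Q * 1- Q * weighted (suc (suc m)) (d n)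
        + Q * ((odd (suc m) + const (+ 2)) * d n (suc m) + - (odd (suc m) * d n (suc (suc m)))) ∎
      where
      Q = q ^ suc n

    weighted-d : ∀ n → weighted (suc n) (d n) ≈ P n * P n
    weighted-d zero = solve 0 (num 0 :+ num 1 :* num 1 := num 1 :* num 1) ≈-refl
    weighted-d (suc n) = begin
      weighted (suc (suc n)) (d (suc n))
        ≈⟨ weighted-d-suc n (suc n) ⟩
      1- Q * 1- Q * (weighted (suc n) (d n) + odd (suc n) * d n (suc n))
        + Q * ((odd (suc n) + const (+ 2)) * d n (suc n) + - (odd (suc n) * d n (suc (suc n))))
        ≈⟨ +-cong (*-cong ≈-refl (+-cong (weighted-d n) (*-cong ≈-refl d≈0)))
             (*-cong ≈-refl (+-cong (*-cong ≈-refl d≈0)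
               (-‿cong (*-cong ≈-refl (d-zero n (suc (suc n)) (ℕ.m≤n⇒m≤1+n ℕ.≤-refl)))))) ⟩
      1- Q * 1- Q * (P n * P n + odd (suc n) * 0s)
        + Q * ((odd (suc n) + const (+ 2)) * 0s + - (odd (suc n) * 0s))
        ≈⟨ solve 3 (λ Q p o → :1- Q :* :1- Q :* (p :* p :+ o :* num 0)
             :+ Q :* ((o :+ num 2) :* num 0 :+ :- (o :* num 0)) := :1- Q :* p :* (:1- Q :* p))
             ≈-refl Q (P n) (odd (suc n)) ⟩
      P (suc n) * P (suc n) ∎
      where
      Q = q ^ suc n
      d≈0 : d n (suc n) ≈ 0s
      d≈0 = d-zero n (suc n) ℕ.≤-refl

  q^k∣signedQ^T : ∀ k → ∃[ f ] signedQ^T k ≈ q ^ k * f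
  q^k∣signedQ^T zero    = 1s , solve 0 (num 1 := num 1 :* num 1) ≈-refl
  q^k∣signedQ^T (suc k) = - signedQ^T k ,
    solve 2 (λ x y → :- (x :* y) := x :* :- y) ≈-refl (q ^ suc k) (signedQ^T k)

  -- By the closed form the product is `signedQ^T k` times a quotient of Euler products. That
  -- quotient is 1 only modulo q^(i+1); the divisor q^k of `signedQ^T k` makes up for the missing k
  -- coefficients.
  E-*-d : ∀ i k → E * d (i ℕ.+ k) k ≈[ suc (i ℕ.+ k) ] signedQ^T k
  E-*-d i k = conclude (q^k∣signedQ^T k)
    where
    n = i ℕ.+ k
    M = suc (n ℕ.+ k)
    N = suc (n ℕ.+ n)
    ratio = E * (P N * (1/P i * 1/P M))

    i≤M : i ℕ.≤ M
    i≤M = ℕ.m≤n⇒m≤1+n (ℕ.≤-trans (ℕ.m≤m+n i k) (ℕ.m≤m+n n k))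

    ratio≈1 : ratio ≈[ suc i ] 1s
    ratio≈1 = begin
      E * (P N * (1/P i * 1/P M))
        ≈⟨ *-cong[] (E-trunc i) (*-cong[] (P-trunc (ℕ.≤-trans i≤M (s≤s (ℕ.+-monoʳ-≤ n (ℕ.m≤n+m k i)))))
             (*-cong[] ≈[]-refl (1/P-trunc i≤M))) ⟩
      P i * (P i * (1/P i * 1/P i))
        ≈⟨ ≈⇒≈[] (solve 2 (λ p r → p :* (p :* (r :* r)) := (p :* r) :* (p :* r)) ≈-refl _ _) ⟩
      P i * 1/P i * (P i * 1/P i)
        ≈⟨ ≈⇒≈[] (≈-trans (*-cong (P-*-1/P i) (P-*-1/P i)) (*-identityˡ 1s)) ⟩
      1s ∎
      where open SetoidReasoning (truncSetoid (suc i))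

    E*d≈ : E * d n k ≈ signedQ^T k * ratio
    E*d≈ = begin
      E * d n k
        ≈⟨ ≈-sym (≈-trans (*-cong ≈-refl (≈-trans (*-cong (P-*-1/P i) (P-*-1/P M)) (*-identityˡ 1s))) (*-identityʳ _)) ⟩
      E * d n k * (P i * 1/P i * (P M * 1/P M))
        ≈⟨ solve 6 (λ e x a b c f → e :* x :* (a :* b :* (c :* f)) := e :* (x :* (a :* c)) :* (b :* f)) ≈-refl _ _ _ _ _ _ ⟩
      E * (d n k * (P i * P M)) * (1/P i * 1/P M)
        ≈⟨ *-cong (*-cong ≈-refl (closedForm n i k refl)) ≈-refl ⟩
      E * (signedQ^T k * P N) * (1/P i * 1/P M)
        ≈⟨ solve 4 (λ e s p r → e :* (s :* p) :* r := s :* (e :* (p :* r))) ≈-refl _ _ _ _ ⟩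
      signedQ^T k * ratio ∎
      where open SetoidReasoning setoid

    conclude : ∃[ f ] signedQ^T k ≈ q ^ k * f → E * d n k ≈[ suc n ] signedQ^T k
    conclude (f , s≈) = begin
      E * d n k           ≈⟨ ≈⇒≈[] E*d≈ ⟩
      signedQ^T k * ratio ≈⟨ ≈⇒≈[] (≈-trans (*-cong s≈ ≈-refl) (*-assoc _ _ _)) ⟩
      q ^ k * (f * ratio) ≈⟨ ≈[]-mono (ℕ.≤-reflexive (≡.trans (cong suc (ℕ.+-comm i k)) (≡.sym (ℕ.+-suc k i))))
                               (q^-*-trunc k (*-cong[] ≈[]-refl ratio≈1)) ⟩
      q ^ k * (f * 1s)    ≈⟨ ≈⇒≈[] (*-cong ≈-refl (*-identityʳ f)) ⟩
      q ^ k * f           ≈⟨ ≈⇒≈[] s≈ ⟨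
      signedQ^T k         ∎
      where open SetoidReasoning (truncSetoid (suc n))

  -- Two of the factors E give P n squared, the weighted sum of the d n k; the third turns each d n
  -- k into `signedQ^T k`.
  jacobi-trunc : ∀ n → cube E ≈[ suc n ] weighted (suc n) signedQ^T
  jacobi-trunc n = begin
    E * E * E                  ≈⟨ *-cong[] (*-cong[] (E-trunc n) (E-trunc n)) ≈[]-refl ⟩
    P n * P n * E              ≈⟨ ≈⇒≈[] (*-cong (weighted-d n) ≈-refl) ⟨
    weighted (suc n) (d n) * E ≈⟨ go (suc n) ℕ.≤-refl ⟩
    weighted (suc n) signedQ^T ∎
    where
    open SetoidReasoning (truncSetoid (suc n))
    go : ∀ m → m ℕ.≤ suc n → weighted m (d n) * E ≈[ suc n ] weighted m signedQ^T
    go zero    _         = ≈⇒≈[] (zeroˡ E)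
    go (suc m) (s≤s m≤n) = begin
      (weighted m (d n) + odd m * d n m) * E
        ≈⟨ ≈⇒≈[] (solve 4 (λ w o x e → (w :+ o :* x) :* e := w :* e :+ o :* (e :* x)) ≈-refl _ _ _ _) ⟩
      weighted m (d n) * E + odd m * (E * d n m)
        ≈⟨ +-cong[] (go m (ℕ.m≤n⇒m≤1+n m≤n)) (*-cong[] ≈[]-refl
             (≡.subst (λ n → E * d n m ≈[ suc n ] signedQ^T m) (ℕ.m∸n+n≡m m≤n) (E-*-d (n ℕ.∸ m) m))) ⟩
      weighted (suc m) signedQ^T ∎

  stretch-q^ : ∀ j → stretch (q ^ j) ≈ q ^ thrice j
  stretch-q^ zero    = stretch-const 1ℤ
  stretch-q^ (suc j) = ≈-trans (stretch-* q (q ^ j))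
    (≈-trans (*-cong stretch-q (stretch-q^ j))
      (solve 2 (λ q x → q :* (q :* q) :* x := q :* (q :* (q :* x))) ≈-refl q _))

  q^-cubed : ∀ j → q ^ j * (q ^ j * q ^ j) ≈ q ^ thrice j
  q^-cubed zero    = solve 0 (num 1 :* (num 1 :* num 1) := num 1) ≈-refl
  q^-cubed (suc j) = ≈-trans
    (solve 2 (λ q x → q :* x :* (q :* x :* (q :* x)) := q :* (q :* (q :* (x :* (x :* x))))) ≈-refl q (q ^ j))
    (*-cong ≈-refl (*-cong ≈-refl (*-cong ≈-refl (q^-cubed j))))

  module _ where
    open SetoidReasoning setoid

    -- The triangular numbers T(3j) and T(3j + 2) are divisible by 3.
    signedQ^T-thrice : ∀ j → ∃[ f ] signedQ^T (thrice j) ≈ stretch f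
    signedQ^T-2+thrice : ∀ j → ∃[ f ] signedQ^T (2 ℕ.+ thrice j) ≈ stretch f

    -- T(3j + 1) = 9 T(j) + 1, and 3j + 1 has the parity opposite to that of j.
    signedQ^T-1+thrice : ∀ j → signedQ^T (1 ℕ.+ thrice j) ≈ - (q * stretch (stretch (signedQ^T j)))

    signedQ^T-thrice zero = 1s , ≈-sym (stretch-const 1ℤ)
    signedQ^T-thrice (suc j) with signedQ^T-2+thrice j
    ... | f , p = - (q ^ suc j * f) , (begin
      - (q ^ thrice (suc j) * signedQ^T (2 ℕ.+ thrice j)) ≈⟨ -‿cong (*-cong (≈-sym (stretch-q^ (suc j))) p) ⟩
      - (stretch (q ^ suc j) * stretch f)                 ≈⟨ -‿cong (stretch-* _ _) ⟨
      - stretch (q ^ suc j * f)                           ≈⟨ stretch-neg _ ⟨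
      stretch (- (q ^ suc j * f))                         ∎)

    signedQ^T-2+thrice j = q ^ suc j * stretch (signedQ^T j) , (begin
      - (q ^ (2 ℕ.+ thrice j) * signedQ^T (1 ℕ.+ thrice j))
        ≈⟨ -‿cong (*-cong ≈-refl (signedQ^T-1+thrice j)) ⟩
      - (q * (q * q ^ thrice j) * - (q * stretch (stretch (signedQ^T j))))
        ≈⟨ solve 3 (λ q x y → :- (q :* (q :* x) :* :- (q :* y)) := q :* (q :* (q :* x)) :* y) ≈-refl q _ _ ⟩
      q ^ thrice (suc j) * stretch (stretch (signedQ^T j))
        ≈⟨ *-cong (stretch-q^ (suc j)) ≈-refl ⟨
      stretch (q ^ suc j) * stretch (stretch (signedQ^T j))
        ≈⟨ stretch-* _ _ ⟨
      stretch (q ^ suc j * stretch (signedQ^T j)) ∎)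

    signedQ^T-1+thrice zero = -‿cong (begin
      q * 1s * 1s ≈⟨ *-identityʳ _ ⟩
      q * 1s      ≈⟨ *-cong ≈-refl (≈-sym (≈-trans (stretch-cong (stretch-const 1ℤ)) (stretch-const 1ℤ))) ⟩
      q * stretch (stretch 1s) ∎)
    signedQ^T-1+thrice (suc j) = begin
      - (q * Q * - (Q * signedQ^T (2 ℕ.+ thrice j)))
        ≈⟨ -‿cong (*-cong ≈-refl (-‿cong (*-cong ≈-refl (-‿cong (*-cong ≈-refl (signedQ^T-1+thrice j)))))) ⟩
      - (q * Q * - (Q * - (q ^ (2 ℕ.+ thrice j) * - (q * X))))
        ≈⟨ solve 3 (λ q x y → let Q = q :* (q :* (q :* x)) in
             :- (q :* Q :* :- (Q :* :- (q :* (q :* x) :* :- (q :* y)))) := :- (q :* :- (Q :* (Q :* (Q :* y)))))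
             ≈-refl q (q ^ thrice j) X ⟩
      - (q * - (Q * (Q * (Q * X))))
        ≈⟨ -‿cong (*-cong ≈-refl (-‿cong (*-cong³ (≈-sym (stretch-q^ (suc j)))))) ⟩
      - (q * - (sq * (sq * (sq * X))))
        ≈⟨ -‿cong (*-cong ≈-refl (-‿cong (≈-trans (solve 2 (λ a b → a :* (a :* (a :* b)) := a :* (a :* a) :* b) ≈-refl sq X)
             (*-cong (≈-trans (*-cong ≈-refl (≈-sym (stretch-* _ _))) (≈-sym (stretch-* _ _))) ≈-refl)))) ⟩
      - (q * - (stretch (q ^ suc j * (q ^ suc j * q ^ suc j)) * X))
        ≈⟨ -‿cong (*-cong ≈-refl (-‿cong (*-cong (stretch-cong cube-q^) ≈-refl))) ⟩
      - (q * - (stretch (stretch (q ^ suc j)) * X))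
        ≈⟨ -‿cong (*-cong ≈-refl (≈-trans (-‿cong (≈-sym (≈-trans (stretch-cong (stretch-* _ _)) (stretch-* _ _))))
             (≈-sym (≈-trans (stretch-cong (stretch-neg _)) (stretch-neg _))))) ⟩
      - (q * stretch (stretch (signedQ^T (suc j)))) ∎
      where
      Q = q ^ thrice (suc j)
      X = stretch (stretch (signedQ^T j))
      sq = stretch (q ^ suc j)
      *-cong³ : ∀ {a b} → a ≈ b → a * (a * (a * X)) ≈ b * (b * (b * X))
      *-cong³ p = *-cong p (*-cong p (*-cong p ≈-refl))
      cube-q^ : q ^ suc j * (q ^ suc j * q ^ suc j) ≈ stretch (q ^ suc j)
      cube-q^ = ≈-trans (q^-cubed (suc j)) (≈-sym (stretch-q^ (suc j)))

    section-odd-* : ∀ r k f → section r (odd k * f) ≈ odd k * section r f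
    section-odd-* r zero f = section-const-* r 1ℤ f
    section-odd-* r (suc k) f = begin
      section r ((odd k + const (+ 2)) * f)
        ≈⟨ section-cong r (solve 2 (λ o f → (o :+ num 2) :* f := o :* f :+ num 2 :* f) ≈-refl (odd k) f) ⟩
      section r (odd k * f + const (+ 2) * f)
        ≈⟨ ≈-trans (section-+ r _ _) (+-cong (section-odd-* r k f) (section-const-* r (+ 2) f)) ⟩
      odd k * section r f + const (+ 2) * section r f
        ≈⟨ solve 2 (λ o f → (o :+ num 2) :* f := o :* f :+ num 2 :* f) ≈-refl (odd k) _ ⟨
      odd (suc k) * section r f ∎

    odd-1+thrice : ∀ j → odd (1 ℕ.+ thrice j) ≈ const (+ 3) * odd j
    odd-1+thrice zero = solve 0 (num 1 :+ num 2 := num 3 :* num 1) ≈-refl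
    odd-1+thrice (suc j) = ≈-trans (+-cong (+-cong (+-cong (odd-1+thrice j) ≈-refl) ≈-refl) ≈-refl)
      (solve 1 (λ o → num 3 :* o :+ num 2 :+ num 2 :+ num 2 := num 3 :* (o :+ num 2)) ≈-refl (odd j))

    stretch-odd : ∀ k → stretch (odd k) ≈ odd k
    stretch-odd zero    = stretch-const 1ℤ
    stretch-odd (suc k) = ≈-trans (stretch-+ _ _) (+-cong (stretch-odd k) (stretch-const (+ 2)))

    -- Only the indices k = 3j + 1 contribute, and their weight is 6j + 3 = 3(2j + 1), so the theta
    -- series reproduces itself. Lengths divisible by 3 make this exact already for finite sums.
    section₁-weighted : ∀ m → section 1F (weighted (thrice m) signedQ^T) ≈ - (const (+ 3) * stretch (weighted m signedQ^T))
    section₁-weighted zero = ≈-trans (section-const₁ 0ℤ)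
      (≈-trans (solve 0 (num 0 := :- (num 3 :* num 0)) ≈-refl) (-‿cong (*-cong ≈-refl (≈-sym (stretch-const 0ℤ)))))
    section₁-weighted (suc m) with signedQ^T-thrice m | signedQ^T-2+thrice m
    ... | f , pf | g , pg = begin
      section 1F (weighted (thrice m) signedQ^T + odd (thrice m) * signedQ^T (thrice m)
        + odd (1 ℕ.+ thrice m) * signedQ^T (1 ℕ.+ thrice m) + odd (2 ℕ.+ thrice m) * signedQ^T (2 ℕ.+ thrice m))
        ≈⟨ ≈-trans (section-+ 1F _ _) (+-cong (≈-trans (section-+ 1F _ _) (+-cong (section-+ 1F _ _) ≈-refl)) ≈-refl) ⟩
      section 1F (weighted (thrice m) signedQ^T) + section 1F (odd (thrice m) * signedQ^T (thrice m))
        + section 1F (odd (1 ℕ.+ thrice m) * signedQ^T (1 ℕ.+ thrice m)) + section 1F (odd (2 ℕ.+ thrice m) * signedQ^T (2 ℕ.+ thrice m))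
        ≈⟨ +-cong (+-cong (+-cong (section₁-weighted m) (section-odd-* 1F (thrice m) _)) (section-odd-* 1F (1 ℕ.+ thrice m) _)) (section-odd-* 1F (2 ℕ.+ thrice m) _) ⟩
      - (const (+ 3) * W) + odd (thrice m) * section 1F (signedQ^T (thrice m))
        + odd (1 ℕ.+ thrice m) * section 1F (signedQ^T (1 ℕ.+ thrice m)) + odd (2 ℕ.+ thrice m) * section 1F (signedQ^T (2 ℕ.+ thrice m))
        ≈⟨ +-cong (+-cong (+-cong ≈-refl (*-cong ≈-refl (≈-trans (section-cong 1F pf) (section-stretch₁ f))))
              (*-cong (odd-1+thrice m) (≈-trans (section-cong 1F (signedQ^T-1+thrice m))
                 (≈-trans (section-neg 1F _) (-‿cong (≈-trans (section-q*₁ _) (section-stretch₀ _)))))))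
              (*-cong ≈-refl (≈-trans (section-cong 1F pg) (section-stretch₁ g))) ⟩
      - (const (+ 3) * W) + odd (thrice m) * 0s + const (+ 3) * odd m * - stretch (signedQ^T m) + odd (2 ℕ.+ thrice m) * 0s
        ≈⟨ solve 5 (λ w a b o s → :- (num 3 :* w) :+ a :* num 0 :+ num 3 :* o :* :- s :+ b :* num 0
             := :- (num 3 :* (w :+ o :* s))) ≈-refl W (odd (thrice m)) _ (odd m) _ ⟩
      - (const (+ 3) * (W + odd m * stretch (signedQ^T m)))
        ≈⟨ -‿cong (*-cong ≈-refl (≈-sym (≈-trans (stretch-+ _ _) (+-cong ≈-refl (≈-trans (stretch-* _ _) (*-cong (stretch-odd m) ≈-refl)))))) ⟩
      - (const (+ 3) * stretch (weighted (suc m) signedQ^T)) ∎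
      where
      W = stretch (weighted m signedQ^T)

    section₂-weighted : ∀ m → section 2F (weighted (thrice m) signedQ^T) ≈ 0s
    section₂-weighted zero = section-const₂ 0ℤ
    section₂-weighted (suc m) with signedQ^T-thrice m | signedQ^T-2+thrice m
    ... | f , pf | g , pg = begin
      section 2F (weighted (thrice m) signedQ^T + odd (thrice m) * signedQ^T (thrice m)
        + odd (1 ℕ.+ thrice m) * signedQ^T (1 ℕ.+ thrice m) + odd (2 ℕ.+ thrice m) * signedQ^T (2 ℕ.+ thrice m))
        ≈⟨ ≈-trans (section-+ 2F _ _) (+-cong (≈-trans (section-+ 2F _ _) (+-cong (section-+ 2F _ _) ≈-refl)) ≈-refl) ⟩
      section 2F (weighted (thrice m) signedQ^T) + section 2F (odd (thrice m) * signedQ^T (thrice m))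
        + section 2F (odd (1 ℕ.+ thrice m) * signedQ^T (1 ℕ.+ thrice m)) + section 2F (odd (2 ℕ.+ thrice m) * signedQ^T (2 ℕ.+ thrice m))
        ≈⟨ +-cong (+-cong (+-cong (section₂-weighted m) (section-odd-* 2F (thrice m) _)) (section-odd-* 2F (1 ℕ.+ thrice m) _)) (section-odd-* 2F (2 ℕ.+ thrice m) _) ⟩
      0s + odd (thrice m) * section 2F (signedQ^T (thrice m))
        + odd (1 ℕ.+ thrice m) * section 2F (signedQ^T (1 ℕ.+ thrice m)) + odd (2 ℕ.+ thrice m) * section 2F (signedQ^T (2 ℕ.+ thrice m))
        ≈⟨ +-cong (+-cong (+-cong ≈-refl (*-cong ≈-refl (≈-trans (section-cong 2F pf) (section-stretch₂ f))))
              (*-cong ≈-refl (≈-trans (section-cong 2F (signedQ^T-1+thrice m))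
                 (≈-trans (section-neg 2F _) (-‿cong (≈-trans (section-q*₂ _) (section-stretch₁ _)))))))
              (*-cong ≈-refl (≈-trans (section-cong 2F pg) (section-stretch₂ g))) ⟩
      0s + odd (thrice m) * 0s + odd (1 ℕ.+ thrice m) * - 0s + odd (2 ℕ.+ thrice m) * 0s
        ≈⟨ solve 3 (λ a b c → num 0 :+ a :* num 0 :+ b :* :- num 0 :+ c :* num 0 := num 0) ≈-refl (odd (thrice m)) (odd (1 ℕ.+ thrice m)) (odd (2 ℕ.+ thrice m)) ⟩
      0s ∎

  section₁-cube-E : section 1F (cube E) ≈ - (const (+ 3) * stretch (cube E))
  section₁-cube-E = ≈[]⇒≈ λ m → ≈[]-mono (ℕ.n≤1+n m)
    -- The index 2 + 3m gives a sum of 3(m + 1) terms and the precision 3(m + 1): a whole number of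
    -- blocks of three.
    (≈[]-trans (section-cong[] 1F (jacobi-trunc (2 ℕ.+ thrice m)))
      (≈[]-trans (≈⇒≈[] (section₁-weighted (suc m)))
        (-‿cong[] (*-cong[] ≈[]-refl (stretch-cong[] (≈[]-sym (jacobi-trunc m)))))))

  section₂-cube-E : section 2F (cube E) ≈ 0s
  section₂-cube-E = ≈[]⇒≈ λ m → ≈[]-mono (ℕ.n≤1+n m)
    (≈[]-trans (section-cong[] 2F (jacobi-trunc (2 ℕ.+ thrice m))) (≈⇒≈[] (section₂-weighted (suc m))))

-- The cubic norm and the norm of (q;q)_∞.

module Norm where
  open FormalPowerSeries
  open Dissection
  open Truncation
  open EulerProduct
  open CubeOfEulerProduct

  -- The norm of a + b x + c x² for x³ = q, written as a cubic form so that no root of unity is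
  -- adjoined.
  normForm : (a b c : PowerSeries) → PowerSeries
  normForm a b c = cube a + q * cube b + q * q * cube c + - (const (+ 3) * (q * (a * b * c)))

  -- The product of f(q), f(ωq), f(ω²q) for a primitive cube root of unity ω, read as a series in q instead of q³.
  norm : PowerSeries → PowerSeries
  norm f = normForm (section 0F f) (section 1F f) (section 2F f)

  private
    :normForm : ∀ {n} (q a b c : Polynomial n) → Polynomial n
    :normForm q a b c = :cube a :+ q :* :cube b :+ q :* q :* :cube c :+ :- (num 3 :* (q :* (a :* b :* c)))

  cube-cong[] : ∀ {n x y} → x ≈[ n ] y → cube x ≈[ n ] cube y
  cube-cong[] p = *-cong[] (*-cong[] p p) p

  normForm-cong : ∀ {a a′ b b′ c c′} → a ≈ a′ → b ≈ b′ → c ≈ c′ → normForm a b c ≈ normForm a′ b′ c′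
  normForm-cong p r s = +-cong (+-cong (+-cong (cube-cong p) (*-cong ≈-refl (cube-cong r)))
    (*-cong ≈-refl (cube-cong s))) (-‿cong (*-cong ≈-refl (*-cong ≈-refl (*-cong (*-cong p r) s))))

  normForm-cong[] : ∀ {n a a′ b b′ c c′} → a ≈[ n ] a′ → b ≈[ n ] b′ → c ≈[ n ] c′ →
    normForm a b c ≈[ n ] normForm a′ b′ c′
  normForm-cong[] p r s = +-cong[] (+-cong[] (+-cong[] (cube-cong[] p) (*-cong[] ≈[]-refl (cube-cong[] r)))
    (*-cong[] ≈[]-refl (cube-cong[] s)))
    (-‿cong[] (*-cong[] ≈[]-refl (*-cong[] ≈[]-refl (*-cong[] (*-cong[] p r) s))))

  norm-cong : ∀ {f g} → f ≈ g → norm f ≈ norm g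
  norm-cong p = normForm-cong (section-cong 0F p) (section-cong 1F p) (section-cong 2F p)

  norm-cong[] : ∀ {n f g} → f ≈[ thrice n ] g → norm f ≈[ n ] norm g
  norm-cong[] p = normForm-cong[] (section-cong[] 0F p) (section-cong[] 1F p) (section-cong[] 2F p)

  norm-dissection : ∀ a b c → norm (dissection a b c) ≈ normForm a b c
  norm-dissection a b c =
    normForm-cong (section-dissection₀ a b c) (section-dissection₁ a b c) (section-dissection₂ a b c)

  module _ where
    open SetoidReasoning setoid

    private
      stretch-dot : ∀ a x b z c y →
        stretch (a * x + (b * z + c * y)) ≈ stretch a * stretch x + (stretch b * stretch z + stretch c * stretch y)
      stretch-dot a x b z c y = ≈-trans (stretch-+ _ _)
        (+-cong (stretch-* a x) (≈-trans (stretch-+ _ _) (+-cong (stretch-* b z) (stretch-* c y))))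

    -- Products whose residues add up to 3 or more wrap around with a factor q³, the stretch of q;
    -- this is the q in front of three of the nine products.
    dissection-* : ∀ a b c x y z → dissection a b c * dissection x y z ≈
      dissection (a * x + (q * b * z + q * c * y)) (a * y + (b * x + q * c * z)) (a * z + (c * x + b * y))
    dissection-* a b c x y z = begin
      dissection a b c * dissection x y z
        ≈⟨ solve 7 (λ q a b c x y z → let q³ = q :* (q :* q) in
             (a :+ q :* b :+ q :* (q :* c)) :* (x :+ q :* y :+ q :* (q :* z))
             := a :* x :+ (q³ :* b :* z :+ q³ :* c :* y) :+ q :* (a :* y :+ (b :* x :+ q³ :* c :* z))
                  :+ q :* (q :* (a :* z :+ (c :* x :+ b :* y)))) ≈-refl q _ _ _ _ _ _ ⟩
      a′ * x′ + (q³ * b′ * z′ + q³ * c′ * y′) + q * (a′ * y′ + (b′ * x′ + q³ * c′ * z′))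
        + q * (q * (a′ * z′ + (c′ * x′ + b′ * y′)))
        ≈⟨ +-cong (+-cong
             (≈-trans (+-cong ≈-refl (+-cong (*-cong (q³* b) ≈-refl) (*-cong (q³* c) ≈-refl))) (≈-sym (stretch-dot a x (q * b) z (q * c) y)))
             (*-cong ≈-refl (≈-trans (+-cong ≈-refl (+-cong ≈-refl (*-cong (q³* c) ≈-refl))) (≈-sym (stretch-dot a y b x (q * c) z)))))
             (*-cong ≈-refl (*-cong ≈-refl (≈-sym (stretch-dot a z c x b y)))) ⟩
      dissection (a * x + (q * b * z + q * c * y)) (a * y + (b * x + q * c * z)) (a * z + (c * x + b * y)) ∎
      where
      q³ = q * (q * q)
      a′ = stretch a
      b′ = stretch b
      c′ = stretch c
      x′ = stretch x
      y′ = stretch y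
      z′ = stretch z
      q³* : ∀ f → q³ * stretch f ≈ stretch (q * f)
      q³* f = ≈-trans (*-cong (≈-sym stretch-q) ≈-refl) (≈-sym (stretch-* q f))

    norm-* : ∀ f g → norm (f * g) ≈ norm f * norm g
    norm-* f g = begin
      norm (f * g)
        ≈⟨ norm-cong (≈-trans (*-cong (dissect f) (dissect g)) (dissection-* a b c x y z)) ⟩
      norm (dissection (a * x + (q * b * z + q * c * y)) (a * y + (b * x + q * c * z)) (a * z + (c * x + b * y)))
        ≈⟨ norm-dissection _ _ _ ⟩
      normForm (a * x + (q * b * z + q * c * y)) (a * y + (b * x + q * c * z)) (a * z + (c * x + b * y))
        ≈⟨ solve 7 (λ q a b c x y z →
             :normForm q (a :* x :+ (q :* b :* z :+ q :* c :* y)) (a :* y :+ (b :* x :+ q :* c :* z)) (a :* z :+ (c :* x :+ b :* y))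
             := :normForm q a b c :* :normForm q x y z) ≈-refl q a b c x y z ⟩
      norm f * norm g ∎
      where
      a = section 0F f
      b = section 1F f
      c = section 2F f
      x = section 0F g
      y = section 1F g
      z = section 2F g

    -- All three conjugates coincide, because q^(3j) is invariant under q ↦ ωq.
    norm-1-q^thrice : ∀ j → norm (1- q ^ thrice j) ≈ cube (1- q ^ j)
    norm-1-q^thrice j = begin
      norm (1- q ^ thrice j)
        ≈⟨ norm-cong (begin
             1- q ^ thrice j         ≈⟨ +-cong ≈-refl (-‿cong (stretch-q^ j)) ⟨
             1- stretch (q ^ j)      ≈⟨ stretch-1- _ ⟨
             stretch (1- q ^ j)      ≈⟨ solve 2 (λ x q → x := x :+ q :* num 0 :+ q :* (q :* num 0)) ≈-refl _ q ⟩
             stretch (1- q ^ j) + q * 0s + q * (q * 0s)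
               ≈⟨ +-cong (+-cong ≈-refl (*-cong ≈-refl (stretch-const 0ℤ))) (*-cong ≈-refl (*-cong ≈-refl (stretch-const 0ℤ))) ⟨
             dissection (1- q ^ j) 0s 0s ∎) ⟩
      norm (dissection (1- q ^ j) 0s 0s)
        ≈⟨ norm-dissection _ _ _ ⟩
      normForm (1- q ^ j) 0s 0s
        ≈⟨ solve 2 (λ q x → :normForm q x (num 0) (num 0) := :cube x) ≈-refl q (1- q ^ j) ⟩
      cube (1- q ^ j) ∎

    -- For k prime to 3 the conjugates of 1 - q^k multiply to 1 - q^(3k), which is 1 - q^k once q³
    -- is read as q.
    norm-1-q^1+thrice : ∀ j → norm (1- q ^ (1 ℕ.+ thrice j)) ≈ 1- q ^ (1 ℕ.+ thrice j)
    norm-1-q^1+thrice j = begin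
      norm (1- (q * q ^ thrice j))
        ≈⟨ norm-cong (begin
             1- (q * q ^ thrice j)
               ≈⟨ +-cong ≈-refl (-‿cong (*-cong ≈-refl (stretch-q^ j))) ⟨
             1- (q * stretch (q ^ j))
               ≈⟨ solve 2 (λ x q → :1- (q :* x) := num 1 :+ q :* :- x :+ q :* (q :* num 0)) ≈-refl _ q ⟩
             1s + q * - stretch (q ^ j) + q * (q * 0s)
               ≈⟨ +-cong (+-cong (stretch-const 1ℤ) (*-cong ≈-refl (stretch-neg _))) (*-cong ≈-refl (*-cong ≈-refl (stretch-const 0ℤ))) ⟨
             dissection 1s (- q ^ j) 0s ∎) ⟩
      norm (dissection 1s (- q ^ j) 0s)
        ≈⟨ norm-dissection _ _ _ ⟩
      normForm 1s (- q ^ j) 0s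
        ≈⟨ solve 2 (λ q x → :normForm q (num 1) (:- x) (num 0) := :1- (q :* (x :* (x :* x)))) ≈-refl q (q ^ j) ⟩
      1- (q * (q ^ j * (q ^ j * q ^ j)))
        ≈⟨ +-cong ≈-refl (-‿cong (*-cong ≈-refl (q^-cubed j))) ⟩
      1- (q * q ^ thrice j) ∎

    norm-1-q^2+thrice : ∀ j → norm (1- q ^ (2 ℕ.+ thrice j)) ≈ 1- q ^ (2 ℕ.+ thrice j)
    norm-1-q^2+thrice j = begin
      norm (1- (q * (q * q ^ thrice j)))
        ≈⟨ norm-cong (begin
             1- (q * (q * q ^ thrice j))
               ≈⟨ +-cong ≈-refl (-‿cong (*-cong ≈-refl (*-cong ≈-refl (stretch-q^ j)))) ⟨
             1- (q * (q * stretch (q ^ j)))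
               ≈⟨ solve 2 (λ x q → :1- (q :* (q :* x)) := num 1 :+ q :* num 0 :+ q :* (q :* :- x)) ≈-refl _ q ⟩
             1s + q * 0s + q * (q * - stretch (q ^ j))
               ≈⟨ +-cong (+-cong (stretch-const 1ℤ) (*-cong ≈-refl (stretch-const 0ℤ))) (*-cong ≈-refl (*-cong ≈-refl (stretch-neg _))) ⟨
             dissection 1s 0s (- q ^ j) ∎) ⟩
      norm (dissection 1s 0s (- q ^ j))
        ≈⟨ norm-dissection _ _ _ ⟩
      normForm 1s 0s (- q ^ j)
        ≈⟨ solve 2 (λ q x → :normForm q (num 1) (num 0) (:- x) := :1- (q :* (q :* (x :* (x :* x))))) ≈-refl q (q ^ j) ⟩
      1- (q * (q * (q ^ j * (q ^ j * q ^ j))))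
        ≈⟨ +-cong ≈-refl (-‿cong (*-cong ≈-refl (*-cong ≈-refl (q^-cubed j)))) ⟩
      1- (q * (q * q ^ thrice j)) ∎

    -- Factors of index prime to 3 are their own norms, while 1 - q^(3j) becomes (1 - q^j)³. The
    -- factor `stretch (P m)` restores the product of the 1 - q^(3j) that have disappeared.
    norm-P : ∀ m → norm (P (thrice m)) * stretch (P m) ≈ P (thrice m) * cube (P m)
    norm-P zero = begin
      norm 1s * stretch 1s
        ≈⟨ *-cong (normForm-cong (section-const₀ 1ℤ) (section-const₁ 1ℤ) (section-const₂ 1ℤ)) (stretch-const 1ℤ) ⟩
      normForm 1s 0s 0s * 1s
        ≈⟨ solve 1 (λ q → :normForm q (num 1) (num 0) (num 0) :* num 1 := num 1 :* :cube (num 1)) ≈-refl q ⟩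
      1s * cube 1s ∎
    norm-P (suc m) = begin
      norm (u₃ * (u₂ * (u₁ * p))) * stretch (1- q ^ suc m * P m)
        ≈⟨ *-cong (≈-trans (norm-* _ _) (*-cong (norm-1-q^thrice (suc m)) (≈-trans (norm-* _ _)
             (*-cong (norm-1-q^2+thrice m) (≈-trans (norm-* _ _) (*-cong (norm-1-q^1+thrice m) ≈-refl))))))
             (≈-trans (stretch-* _ _) (*-cong (≈-trans (stretch-1- _) (+-cong ≈-refl (-‿cong (stretch-q^ (suc m))))) ≈-refl)) ⟩
      cube u * (u₂ * (u₁ * norm p)) * (u₃ * stretch (P m))
        ≈⟨ solve 6 (λ u a b c n s → :cube u :* (b :* (a :* n)) :* (c :* s) := c :* b :* a :* :cube u :* (n :* s)) ≈-refl u u₁ u₂ u₃ (norm p) _ ⟩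
      u₃ * u₂ * u₁ * cube u * (norm p * stretch (P m))
        ≈⟨ *-cong ≈-refl (norm-P m) ⟩
      u₃ * u₂ * u₁ * cube u * (p * cube (P m))
        ≈⟨ solve 6 (λ u a b c p x → c :* b :* a :* :cube u :* (p :* :cube x) := c :* (b :* (a :* p)) :* :cube (u :* x)) ≈-refl u u₁ u₂ u₃ p (P m) ⟩
      P (thrice (suc m)) * cube (P (suc m)) ∎
      where
      p = P (thrice m)
      u = 1- q ^ suc m
      u₁ = 1- q ^ (1 ℕ.+ thrice m)
      u₂ = 1- q ^ (2 ℕ.+ thrice m)
      u₃ = 1- q ^ (3 ℕ.+ thrice m)

  n≤thrice : ∀ n → n ℕ.≤ thrice n
  n≤thrice zero    = z≤n
  n≤thrice (suc n) = s≤s (ℕ.m≤n⇒m≤1+n (ℕ.m≤n⇒m≤1+n (n≤thrice n)))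

  norm-E : norm E * stretch E ≈ E * cube E
  norm-E = ≈[]⇒≈ λ n →
    let
      E≈P : E ≈[ n ] P n
      E≈P = ≈[]-mono (ℕ.n≤1+n n) (E-trunc n)
      E≈P₃ : E ≈[ thrice n ] P (thrice n)
      E≈P₃ = ≈[]-mono (ℕ.n≤1+n _) (E-trunc (thrice n))
    in
    ≈[]-trans (*-cong[] (norm-cong[] E≈P₃) (stretch-cong[] E≈P))
      (≈[]-trans (≈⇒≈[] (norm-P n))
        (≈[]-sym (*-cong[] (≈[]-mono (n≤thrice n) E≈P₃) (cube-cong[] E≈P))))

-- The cubic equation of y over series in q³, and expansions in 1, z, z².

module CubicRelation where
  open FormalPowerSeries
  open Dissection
  open EulerProduct
  open CubeOfEulerProduct
  open Norm

  open SetoidReasoning setoid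

  infix 4 _∈ℤ[_]
  -- An inductive predicate, so that facts about ℤ[x] are proved by induction on the expression and
  -- no normal form of polynomials is required.
  data _∈ℤ[_] : PowerSeries → PowerSeries → Set where
    const∈ : ∀ {x} c → const c ∈ℤ[ x ]
    gen∈   : ∀ {x} → x ∈ℤ[ x ]
    +∈     : ∀ {x f g} → f ∈ℤ[ x ] → g ∈ℤ[ x ] → f + g ∈ℤ[ x ]
    *∈     : ∀ {x f g} → f ∈ℤ[ x ] → g ∈ℤ[ x ] → f * g ∈ℤ[ x ]

  -- E³ = A − 3B with A = a(q³), B = q b(q³).
  C c a b D κ A B : PowerSeries
  C = cube E
  c = cube 1/E
  a = section 0F C
  b = stretch C
  D = cube a + - (const (+ 27) * (q * cube b))
  κ = pow4 c * b
  A = stretch a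
  B = q * stretch b

  -- The exact identities are proved for the unscaled y and t; the multiples z and s carry the
  -- divisibility by 3.
  t s y z : PowerSeries
  t = κ * (q * cube b)
  s = const (+ 27) * t
  y = B * c
  z = const (+ 3) * y

  C*c≈1 : C * c ≈ 1s
  C*c≈1 = ≈-trans (solve 2 (λ e f → :cube e :* :cube f := :cube (e :* f)) ≈-refl E 1/E)
    (≈-trans (cube-cong E-*-1/E) (solve 0 (:cube (num 1) := num 1) ≈-refl))

  stretch-c*b≈1 : stretch c * b ≈ 1s
  stretch-c*b≈1 = ≈-trans (≈-sym (stretch-* c C))
    (≈-trans (stretch-cong (≈-trans (*-comm c C) C*c≈1)) (stretch-const 1ℤ))

  C-dissection : C ≈ dissection a (- (const (+ 3) * b)) 0s
  C-dissection = ≈-trans (dissect C)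
    (dissection-cong ≈-refl section₁-cube-E section₂-cube-E)

  C≈A-3B : C ≈ A + - (const (+ 3) * B)
  C≈A-3B = begin
    C ≈⟨ C-dissection ⟩
    A + q * stretch (- (const (+ 3) * b)) + q * (q * stretch 0s)
      ≈⟨ +-cong (+-cong ≈-refl (*-cong ≈-refl (≈-trans (stretch-neg _) (-‿cong (≈-trans (stretch-* _ _) (*-cong (stretch-const (+ 3)) ≈-refl))))))
                (*-cong ≈-refl (*-cong ≈-refl (stretch-const 0ℤ))) ⟩
    A + q * - (const (+ 3) * stretch b) + q * (q * 0s)
      ≈⟨ solve 3 (λ A q b → A :+ q :* :- (num 3 :* b) :+ q :* (q :* num 0) := A :+ :- (num 3 :* (q :* b))) ≈-refl A q (stretch b) ⟩
    A + - (const (+ 3) * B) ∎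

  -- D is the norm form of the dissection of C, hence the cube of the norm of E, and that norm is E⁴
  -- / φ(E).
  D*b≈C⁴ : D * b ≈ pow4 C
  D*b≈C⁴ = begin
    D * b
      ≈⟨ *-cong (≈-sym (≈-trans (norm-cong C-dissection) (≈-trans (norm-dissection _ _ _)
           (solve 3 (λ q a b → let x = :- (num 3 :* b) in
              :cube a :+ q :* :cube x :+ q :* q :* :cube (num 0) :+ :- (num 3 :* (q :* (a :* x :* num 0)))
              := :cube a :+ :- (num 27 :* (q :* :cube b))) ≈-refl q a b))))
           (stretch-cube E) ⟩
    norm C * cube (stretch E)
      ≈⟨ *-cong (≈-trans (norm-* _ _) (*-cong (norm-* E E) ≈-refl)) ≈-refl ⟩
    cube (norm E) * cube (stretch E)
      ≈⟨ solve 2 (λ e f → :cube e :* :cube f := :cube (e :* f)) ≈-refl (norm E) (stretch E) ⟩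
    cube (norm E * stretch E)
      ≈⟨ cube-cong norm-E ⟩
    cube (E * cube E)
      ≈⟨ solve 1 (λ e → :cube (e :* :cube e) := :4 (:cube e)) ≈-refl E ⟩
    pow4 C ∎

  κ*D≈1 : κ * D ≈ 1s
  κ*D≈1 = begin
    pow4 c * b * D   ≈⟨ solve 3 (λ c b D → c :* b :* D := D :* b :* c) ≈-refl (pow4 c) b D ⟩
    D * b * pow4 c   ≈⟨ *-cong D*b≈C⁴ ≈-refl ⟩
    pow4 C * pow4 c  ≈⟨ solve 2 (λ C c → :4 C :* :4 c := :4 (C :* c)) ≈-refl C c ⟩
    pow4 (C * c)     ≈⟨ *-cong (*-cong (*-cong C*c≈1 C*c≈1) C*c≈1) C*c≈1 ⟩
    pow4 1s          ≈⟨ solve 0 (:4 (num 1) := num 1) ≈-refl ⟩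
    1s               ∎

  stretch-κD : stretch κ * stretch D ≈ 1s
  stretch-κD = ≈-trans (≈-sym (stretch-* κ D)) (≈-trans (stretch-cong κ*D≈1) (stretch-const 1ℤ))

  qb³-stretch : stretch (q * cube b) ≈ cube B
  qb³-stretch = ≈-trans (stretch-* _ _) (≈-trans (*-cong stretch-q (stretch-cube b))
    (solve 2 (λ q b → q :* (q :* q) :* :cube b := :cube (q :* b)) ≈-refl q (stretch b)))

  stretch-D : stretch D ≈ cube A + - (const (+ 27) * cube B)
  stretch-D = ≈-trans (stretch-+ _ _) (+-cong (stretch-cube a)
    (≈-trans (stretch-neg _) (-‿cong (≈-trans (stretch-* _ _) (*-cong (stretch-const (+ 27)) qb³-stretch)))))

  numerator : PowerSeries
  numerator = A * A + const (+ 3) * (A * B) + const (+ 9) * (B * B)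

  c≈ : c ≈ stretch κ * numerator
  c≈ = begin
    c
      ≈⟨ ≈-sym (≈-trans (*-cong stretch-κD ≈-refl) (*-identityˡ c)) ⟩
    stretch κ * stretch D * c
      ≈⟨ *-cong (*-cong ≈-refl stretch-D) ≈-refl ⟩
    stretch κ * (cube A + - (const (+ 27) * cube B)) * c
      -- `numerator` is the cofactor of A - 3B in A³ - 27B³.
      ≈⟨ solve 4 (λ k A B c → k :* (:cube A :+ :- (num 27 :* :cube B)) :* c
           := k :* (A :* A :+ num 3 :* (A :* B) :+ num 9 :* (B :* B)) :* ((A :+ :- (num 3 :* B)) :* c))
           ≈-refl (stretch κ) A B c ⟩
    stretch κ * numerator * ((A + - (const (+ 3) * B)) * c)
      ≈⟨ *-cong ≈-refl (≈-trans (*-cong (≈-sym C≈A-3B) ≈-refl) C*c≈1) ⟩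
    stretch κ * numerator * 1s
      ≈⟨ *-identityʳ _ ⟩
    stretch κ * numerator ∎

  -- Substituting A = C + 3B removes A, so that division by C³ leaves a polynomial in y alone.
  stretch-D′ : stretch D ≈ cube C + const (+ 9) * (B * (C * C)) + const (+ 27) * (B * B * C)
  stretch-D′ = begin
    stretch D ≈⟨ stretch-D ⟩
    cube A + - (const (+ 27) * cube B)
      ≈⟨ solve 2 (λ A B → let C = A :+ :- (num 3 :* B) in :cube A :+ :- (num 27 :* :cube B)
           := :cube C :+ num 9 :* (B :* (C :* C)) :+ num 27 :* (B :* B :* C)) ≈-refl A B ⟩
    cube C′ + const (+ 9) * (B * (C′ * C′)) + const (+ 27) * (B * B * C′)
      ≈⟨ +-cong (+-cong (cube-cong C≈A-3B) (*-cong ≈-refl (*-cong ≈-refl (*-cong C≈A-3B C≈A-3B)))) (*-cong ≈-refl (*-cong ≈-refl C≈A-3B)) ⟨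
    cube C + const (+ 9) * (B * (C * C)) + const (+ 27) * (B * B * C) ∎
    where
    C′ = A + - (const (+ 3) * B)

  stretch-D*c³ : stretch D * cube c ≈ 1s + const (+ 9) * y + const (+ 27) * (y * y)
  stretch-D*c³ = begin
    stretch D * cube c
      ≈⟨ *-cong stretch-D′ ≈-refl ⟩
    (cube C + const (+ 9) * (B * (C * C)) + const (+ 27) * (B * B * C)) * cube c
      ≈⟨ solve 3 (λ C c B → (:cube C :+ num 9 :* (B :* (C :* C)) :+ num 27 :* (B :* B :* C)) :* :cube c
           := :cube (C :* c) :+ num 9 :* (B :* c :* ((C :* c) :* (C :* c))) :+ num 27 :* (B :* c :* (B :* c) :* (C :* c))) ≈-refl C c B ⟩
    cube (C * c) + const (+ 9) * (y * ((C * c) * (C * c))) + const (+ 27) * (y * y * (C * c))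
      ≈⟨ +-cong (+-cong (cube-cong C*c≈1) (*-cong ≈-refl (*-cong ≈-refl (*-cong C*c≈1 C*c≈1)))) (*-cong ≈-refl (*-cong ≈-refl C*c≈1)) ⟩
    cube 1s + const (+ 9) * (y * (1s * 1s)) + const (+ 27) * (y * y * 1s)
      ≈⟨ solve 1 (λ y → :cube (num 1) :+ num 9 :* (y :* (num 1 :* num 1)) :+ num 27 :* (y :* y :* num 1)
           := num 1 :+ num 9 :* y :+ num 27 :* (y :* y)) ≈-refl y ⟩
    1s + const (+ 9) * y + const (+ 27) * (y * y) ∎

  stretch-D*stretch-b : stretch D * stretch b ≈ pow4 b
  stretch-D*stretch-b = ≈-trans (≈-sym (stretch-* D b)) (≈-trans (stretch-cong D*b≈C⁴) (stretch-pow4 C))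

  -- Together with `y³≈` this parametrises the relation between t and φ(t) by y: both are rational
  -- functions of y.
  t≈ : t ≈ y * (1s + const (+ 9) * y + const (+ 27) * (y * y))
  t≈ = begin
    pow4 c * b * (q * cube b)
      ≈⟨ solve 3 (λ c b q → :4 c :* b :* (q :* :cube b) := q :* :4 c :* :4 b) ≈-refl c b q ⟩
    q * pow4 c * pow4 b
      ≈⟨ *-cong ≈-refl stretch-D*stretch-b ⟨
    q * pow4 c * (stretch D * stretch b)
      ≈⟨ solve 4 (λ q c D b → q :* :4 c :* (D :* b) := q :* b :* c :* (D :* :cube c)) ≈-refl q c (stretch D) (stretch b) ⟩
    y * (stretch D * cube c)
      ≈⟨ *-cong ≈-refl stretch-D*c³ ⟩
    y * (1s + const (+ 9) * y + const (+ 27) * (y * y)) ∎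

  stretch-t : stretch t ≈ stretch κ * cube B
  stretch-t = ≈-trans (stretch-* _ _) (*-cong ≈-refl qb³-stretch)

  y³≈ : cube y ≈ stretch t * (1s + const (+ 9) * y + const (+ 27) * (y * y))
  y³≈ = begin
    cube (B * c)
      ≈⟨ *-identityˡ _ ⟨
    1s * cube (B * c)
      ≈⟨ *-cong stretch-κD ≈-refl ⟨
    stretch κ * stretch D * cube (B * c)
      ≈⟨ solve 4 (λ k d B c → k :* d :* :cube (B :* c) := k :* :cube B :* (d :* :cube c)) ≈-refl _ _ B c ⟩
    stretch κ * cube B * (stretch D * cube c)
      ≈⟨ *-cong (≈-sym stretch-t) stretch-D*c³ ⟩
    stretch t * (1s + const (+ 9) * y + const (+ 27) * (y * y)) ∎

  dissection-c : c ≈ dissection (κ * (a * a)) (κ * (const (+ 3) * (a * b))) (κ * (const (+ 9) * (b * b)))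
  dissection-c = begin
    c ≈⟨ c≈ ⟩
    stretch κ * numerator
      ≈⟨ solve 4 (λ k A q b → k :* (A :* A :+ num 3 :* (A :* (q :* b)) :+ num 9 :* (q :* b :* (q :* b)))
           := k :* (A :* A) :+ q :* (k :* (num 3 :* (A :* b))) :+ q :* (q :* (k :* (num 9 :* (b :* b))))) ≈-refl (stretch κ) A q (stretch b) ⟩
    stretch κ * (A * A) + q * (stretch κ * (const (+ 3) * (A * stretch b))) + q * (q * (stretch κ * (const (+ 9) * (stretch b * stretch b))))
      ≈⟨ +-cong (+-cong (≈-sym (≈-trans (stretch-* _ _) (*-cong ≈-refl (stretch-* a a)))) (*-cong ≈-refl (≈-sym (stretch-κ* (+ 3) a b))))
            (*-cong ≈-refl (*-cong ≈-refl (≈-sym (stretch-κ* (+ 9) b b)))) ⟩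
    dissection (κ * (a * a)) (κ * (const (+ 3) * (a * b))) (κ * (const (+ 9) * (b * b))) ∎
    where
    stretch-κ* : ∀ k f g → stretch (κ * (const k * (f * g))) ≈ stretch κ * (const k * (stretch f * stretch g))
    stretch-κ* k f g = ≈-trans (stretch-* _ _) (*-cong ≈-refl (≈-trans (stretch-* _ _)
      (*-cong (stretch-const k) (stretch-* f g))))

  y₁ y₂ : PowerSeries
  y₁ = κ * (a * (a * b))
  y₂ = κ * (const (+ 3) * (a * (b * b)))

  -- y is c times q and a series in q³, so its components are those of c moved by one class and
  -- multiplied by b, with a carry q into class 0.
  dissection-y : y ≈ dissection (const (+ 9) * t) y₁ y₂
  dissection-y = begin
    q * stretch b * c
      ≈⟨ *-cong (solve 2 (λ q b → q :* b := num 0 :+ q :* b :+ q :* (q :* num 0)) ≈-refl q (stretch b)) ≈-refl ⟩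
    (0s + q * stretch b + q * (q * 0s)) * c
      ≈⟨ *-cong (+-cong (+-cong (≈-sym (stretch-const 0ℤ)) ≈-refl) (*-cong ≈-refl (*-cong ≈-refl (≈-sym (stretch-const 0ℤ))))) dissection-c ⟩
    dissection 0s b 0s * dissection (κ * (a * a)) (κ * (const (+ 3) * (a * b))) (κ * (const (+ 9) * (b * b)))
      ≈⟨ dissection-* _ _ _ _ _ _ ⟩
    dissection (0s * c₀ + (q * b * c₂ + q * 0s * c₁)) (0s * c₁ + (b * c₀ + q * 0s * c₂)) (0s * c₂ + (0s * c₀ + b * c₁))
      ≈⟨ dissection-cong
           (solve 4 (λ q k a b → num 0 :* (k :* (a :* a)) :+ (q :* b :* (k :* (num 9 :* (b :* b))) :+ q :* num 0 :* (k :* (num 3 :* (a :* b))))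
              := num 9 :* (k :* (q :* :cube b))) ≈-refl q κ a b)
           (solve 4 (λ q k a b → num 0 :* (k :* (num 3 :* (a :* b))) :+ (b :* (k :* (a :* a)) :+ q :* num 0 :* (k :* (num 9 :* (b :* b))))
              := k :* (a :* (a :* b))) ≈-refl q κ a b)
           (solve 3 (λ k a b → num 0 :* (k :* (num 9 :* (b :* b))) :+ (num 0 :* (k :* (a :* a)) :+ b :* (k :* (num 3 :* (a :* b))))
              := k :* (num 3 :* (a :* (b :* b)))) ≈-refl κ a b) ⟩
    dissection (const (+ 9) * t) y₁ y₂ ∎
    where
    c₀ = κ * (a * a)
    c₁ = κ * (const (+ 3) * (a * b))
    c₂ = κ * (const (+ 9) * (b * b))

  section₀-y : section 0F y ≈ const (+ 9) * t
  section₀-y = ≈-trans (section-cong 0F dissection-y) (section-dissection₀ _ _ _)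

  -- The square of the class 0 component gives 81t². The cross terms give 6 q κ² a³ b³, and a³ = D +
  -- 27 q b³ with κ D = 1 turns them into 6t + 162t².
  section₀-y² : section 0F (y * y) ≈ const (+ 6) * t + const (+ 243) * (t * t)
  section₀-y² = begin
    section 0F (y * y)
      ≈⟨ section-cong 0F (≈-trans (*-cong dissection-y dissection-y) (dissection-* _ _ _ _ _ _)) ⟩
    section 0F (dissection (const (+ 9) * t * (const (+ 9) * t) + (q * y₁ * y₂ + q * y₂ * y₁)) _ _)
      ≈⟨ section-dissection₀ _ _ _ ⟩
    const (+ 9) * t * (const (+ 9) * t) + (q * y₁ * y₂ + q * y₂ * y₁)
      ≈⟨ solve 4 (λ q k a b → let t = k :* (q :* :cube b) in
           num 9 :* t :* (num 9 :* t) :+ (q :* (k :* (a :* (a :* b))) :* (k :* (num 3 :* (a :* (b :* b))))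
             :+ q :* (k :* (num 3 :* (a :* (b :* b)))) :* (k :* (a :* (a :* b))))
           := num 6 :* (t :* (k :* (:cube a :+ :- (num 27 :* (q :* :cube b))))) :+ num 243 :* (t :* t)) ≈-refl q κ a b ⟩
    const (+ 6) * (t * (κ * D)) + const (+ 243) * (t * t)
      ≈⟨ +-cong (*-cong ≈-refl (≈-trans (*-cong ≈-refl κ*D≈1) (*-identityʳ t))) ≈-refl ⟩
    const (+ 6) * t + const (+ 243) * (t * t) ∎

  -- The relations z³ = s(q³)(1 + 3z + 3z²) and s = 9(z + 3z² + 3z³) make 1, z, z² generate ℤ[z] ⊇ ℤ[s] over ℤ[s(q³)].
  record Expansion (f : PowerSeries) : Set where
    constructor expansion
    field
      {e₀ e₁ e₂} : PowerSeries
      e₀∈ : e₀ ∈ℤ[ s ]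
      e₁∈ : e₁ ∈ℤ[ s ]
      e₂∈ : e₂ ∈ℤ[ s ]
      equation : f ≈ stretch e₀ + stretch e₁ * z + stretch e₂ * (z * z)

  z³≈ : cube z ≈ stretch s * (1s + const (+ 3) * z + const (+ 3) * (z * z))
  z³≈ = begin
    cube (const (+ 3) * y)
      ≈⟨ solve 1 (λ y → :cube (num 3 :* y) := num 27 :* :cube y) ≈-refl y ⟩
    const (+ 27) * cube y
      ≈⟨ *-cong ≈-refl y³≈ ⟩
    const (+ 27) * (stretch t * (1s + const (+ 9) * y + const (+ 27) * (y * y)))
      ≈⟨ solve 2 (λ t y → let z = num 3 :* y in num 27 :* (t :* (num 1 :+ num 9 :* y :+ num 27 :* (y :* y)))
           := num 27 :* t :* (num 1 :+ num 3 :* z :+ num 3 :* (z :* z))) ≈-refl (stretch t) y ⟩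
    const (+ 27) * stretch t * (1s + const (+ 3) * z + const (+ 3) * (z * z))
      ≈⟨ *-cong (≈-trans (stretch-* _ _) (*-cong (stretch-const (+ 27)) ≈-refl)) ≈-refl ⟨
    stretch s * (1s + const (+ 3) * z + const (+ 3) * (z * z)) ∎

  s≈ : s ≈ const (+ 9) * z + const (+ 27) * (z * z) + const (+ 27) * cube z
  s≈ = ≈-trans (*-cong ≈-refl t≈)
    (solve 1 (λ y → let z = num 3 :* y in num 27 :* (y :* (num 1 :+ num 9 :* y :+ num 27 :* (y :* y)))
       := num 9 :* z :+ num 27 :* (z :* z) :+ num 27 :* :cube z) ≈-refl y)

  private
    ∈3s : const (+ 3) * s ∈ℤ[ s ]
    ∈3s = *∈ (const∈ (+ 3)) gen∈

  -- Induction on the expression. Products create z³ and z⁴, which `z³≈` reduces with coefficients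
  -- that stay in the stretched ring.
  expand : ∀ {f} → f ∈ℤ[ s ] → Expansion f
  expand (const∈ k) = expansion (const∈ k) (const∈ 0ℤ) (const∈ 0ℤ) (begin
    const k
      ≈⟨ solve 2 (λ k z → k := k :+ num 0 :* z :+ num 0 :* (z :* z)) ≈-refl (const k) z ⟩
    const k + 0s * z + 0s * (z * z)
      ≈⟨ +-cong (+-cong (stretch-const k) (*-cong (stretch-const 0ℤ) ≈-refl)) (*-cong (stretch-const 0ℤ) ≈-refl) ⟨
    stretch (const k) + stretch 0s * z + stretch 0s * (z * z) ∎)
  -- These coefficients arise from `s≈` when z³ is replaced by σ(1 + 3z + 3z²).
  expand gen∈ = expansion {e₀ = const (+ 27) * s} {const (+ 9) + const (+ 81) * s} {const (+ 27) + const (+ 81) * s}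
    (*∈ (const∈ _) gen∈) (+∈ (const∈ _) (*∈ (const∈ _) gen∈)) (+∈ (const∈ _) (*∈ (const∈ _) gen∈)) (begin
    s
      ≈⟨ ≈-trans s≈ (+-cong ≈-refl (*-cong ≈-refl z³≈)) ⟩
    const (+ 9) * z + const (+ 27) * (z * z) + const (+ 27) * (σ * (1s + const (+ 3) * z + const (+ 3) * (z * z)))
      ≈⟨ solve 2 (λ z σ → num 9 :* z :+ num 27 :* (z :* z) :+ num 27 :* (σ :* (num 1 :+ num 3 :* z :+ num 3 :* (z :* z)))
           := num 27 :* σ :+ (num 9 :+ num 81 :* σ) :* z :+ (num 27 :+ num 81 :* σ) :* (z :* z)) ≈-refl z σ ⟩
    const (+ 27) * σ + (const (+ 9) + const (+ 81) * σ) * z + (const (+ 27) + const (+ 81) * σ) * (z * z)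
      ≈⟨ +-cong (+-cong (stretch-const-* _ s) (*-cong (stretch-affine (+ 9)) ≈-refl)) (*-cong (stretch-affine (+ 27)) ≈-refl) ⟨
    stretch (const (+ 27) * s) + stretch (const (+ 9) + const (+ 81) * s) * z + stretch (const (+ 27) + const (+ 81) * s) * (z * z) ∎)
    where
    σ = stretch s
    stretch-affine : ∀ k → stretch (const k + const (+ 81) * s) ≈ const k + const (+ 81) * σ
    stretch-affine k = ≈-trans (stretch-+ _ _) (+-cong (stretch-const k) (stretch-const-* (+ 81) s))
  expand (+∈ {f = f} {g} f∈ g∈) with expand f∈ | expand g∈
  ... | expansion {e₀} {e₁} {e₂} p₀ p₁ p₂ p | expansion {d₀} {d₁} {d₂} r₀ r₁ r₂ r =
    expansion (+∈ p₀ r₀) (+∈ p₁ r₁) (+∈ p₂ r₂) (begin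
      f + g
        ≈⟨ +-cong p r ⟩
      stretch e₀ + stretch e₁ * z + stretch e₂ * (z * z) + (stretch d₀ + stretch d₁ * z + stretch d₂ * (z * z))
        ≈⟨ solve 7 (λ z a b c x y w → a :+ b :* z :+ c :* (z :* z) :+ (x :+ y :* z :+ w :* (z :* z))
             := (a :+ x) :+ (b :+ y) :* z :+ (c :+ w) :* (z :* z)) ≈-refl z _ _ _ _ _ _ ⟩
      stretch e₀ + stretch d₀ + (stretch e₁ + stretch d₁) * z + (stretch e₂ + stretch d₂) * (z * z)
        ≈⟨ +-cong (+-cong (stretch-+ _ _) (*-cong (stretch-+ _ _) ≈-refl)) (*-cong (stretch-+ _ _) ≈-refl) ⟨
      stretch (e₀ + d₀) + stretch (e₁ + d₁) * z + stretch (e₂ + d₂) * (z * z) ∎)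
  expand (*∈ {f = f} {g} f∈ g∈) with expand f∈ | expand g∈
  ... | expansion {e₀} {e₁} {e₂} p₀ p₁ p₂ p | expansion {d₀} {d₁} {d₂} r₀ r₁ r₂ r =
    -- `h₃` and `h₄` are the coefficients of z³ and z⁴, where z⁴ = σ(3σ + (1 + 9σ)z + (3 + 9σ)z²).
    expansion {e₀ = h₀ + s * (h₃ + const (+ 3) * s * h₄)}
              {h₁ + s * (const (+ 3) * h₃ + (const (+ 1) + const (+ 9) * s) * h₄)}
              {h₂ + s * (const (+ 3) * h₃ + (const (+ 3) + const (+ 9) * s) * h₄)}
      (+∈ (*∈ p₀ r₀) (*∈ gen∈ (+∈ h₃∈ (*∈ ∈3s h₄∈))))
      (+∈ (+∈ (*∈ p₀ r₁) (*∈ p₁ r₀)) (*∈ gen∈ (+∈ (*∈ (const∈ _) h₃∈) (*∈ (+∈ (const∈ _) (*∈ (const∈ _) gen∈)) h₄∈))))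
      (+∈ (+∈ (*∈ p₀ r₂) (+∈ (*∈ p₁ r₁) (*∈ p₂ r₀))) (*∈ gen∈ (+∈ (*∈ (const∈ _) h₃∈) (*∈ (+∈ (const∈ _) (*∈ (const∈ _) gen∈)) h₄∈))))
    (begin
      f * g
        ≈⟨ *-cong p r ⟩
      (E₀ + E₁ * z + E₂ * (z * z)) * (D₀ + D₁ * z + D₂ * (z * z))
        ≈⟨ solve 7 (λ z a b c x y w → (a :+ b :* z :+ c :* (z :* z)) :* (x :+ y :* z :+ w :* (z :* z))
             := a :* x :+ (a :* y :+ b :* x) :* z :+ (a :* w :+ (b :* y :+ c :* x)) :* (z :* z)
                :+ (b :* w :+ c :* y) :* :cube z :+ c :* w :* (z :* :cube z)) ≈-refl z E₀ E₁ E₂ D₀ D₁ D₂ ⟩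
      E₀ * D₀ + (E₀ * D₁ + E₁ * D₀) * z + (E₀ * D₂ + (E₁ * D₁ + E₂ * D₀)) * (z * z)
        + (E₁ * D₂ + E₂ * D₁) * cube z + E₂ * D₂ * (z * cube z)
        ≈⟨ +-cong (+-cong (+-cong (+-cong (stretch-* e₀ d₀) (*-cong H₁≈ ≈-refl)) (*-cong H₂≈ ≈-refl))
             (*-cong H₃≈ (≈-sym z³≈))) (*-cong (stretch-* e₂ d₂) (*-cong ≈-refl (≈-sym z³≈))) ⟨
      H₀ + H₁ * z + H₂ * (z * z) + H₃ * (σ * (1s + const (+ 3) * z + const (+ 3) * (z * z)))
        + H₄ * (z * (σ * (1s + const (+ 3) * z + const (+ 3) * (z * z))))
        ≈⟨ solve 7 (λ z σ a b c x y → let w = σ :* (num 1 :+ num 3 :* z :+ num 3 :* (z :* z)) in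
              a :+ b :* z :+ c :* (z :* z) :+ x :* w :+ y :* (z :* w)
              := a :+ b :* z :+ c :* (z :* z) :+ x :* w :+ y :* (σ :* (z :+ num 3 :* (z :* z) :+ num 3 :* :cube z)))
              ≈-refl z σ H₀ H₁ H₂ H₃ H₄ ⟩
      H₀ + H₁ * z + H₂ * (z * z) + H₃ * (σ * (1s + const (+ 3) * z + const (+ 3) * (z * z)))
        + H₄ * (σ * (z + const (+ 3) * (z * z) + const (+ 3) * cube z))
        ≈⟨ +-cong ≈-refl (*-cong ≈-refl (*-cong ≈-refl (+-cong ≈-refl (*-cong ≈-refl z³≈)))) ⟩
      H₀ + H₁ * z + H₂ * (z * z) + H₃ * (σ * (1s + const (+ 3) * z + const (+ 3) * (z * z)))
        + H₄ * (σ * (z + const (+ 3) * (z * z) + const (+ 3) * (σ * (1s + const (+ 3) * z + const (+ 3) * (z * z)))))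
        ≈⟨ solve 7 (λ z σ a b c x y → let w = σ :* (num 1 :+ num 3 :* z :+ num 3 :* (z :* z)) in
              a :+ b :* z :+ c :* (z :* z) :+ x :* w :+ y :* (σ :* (z :+ num 3 :* (z :* z) :+ num 3 :* w))
              := a :+ σ :* (x :+ num 3 :* σ :* y)
                 :+ (b :+ σ :* (num 3 :* x :+ (num 1 :+ num 9 :* σ) :* y)) :* z
                 :+ (c :+ σ :* (num 3 :* x :+ (num 3 :+ num 9 :* σ) :* y)) :* (z :* z))
              ≈-refl z σ H₀ H₁ H₂ H₃ H₄ ⟩
      H₀ + σ * (H₃ + const (+ 3) * σ * H₄)
        + (H₁ + σ * (const (+ 3) * H₃ + (const (+ 1) + const (+ 9) * σ) * H₄)) * z
        + (H₂ + σ * (const (+ 3) * H₃ + (const (+ 3) + const (+ 9) * σ) * H₄)) * (z * z)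
        ≈⟨ +-cong (+-cong (≈-trans (stretch-+ _ _) (+-cong ≈-refl (≈-trans (stretch-* _ _) (*-cong ≈-refl
               (≈-trans (stretch-+ _ _) (+-cong ≈-refl (≈-trans (stretch-* _ _) (*-cong (stretch-const-* _ s) ≈-refl))))))))
             (*-cong (stretch-e h₁ 1) ≈-refl)) (*-cong (stretch-e h₂ 3) ≈-refl) ⟨
      stretch (h₀ + s * (h₃ + const (+ 3) * s * h₄))
        + stretch (h₁ + s * (const (+ 3) * h₃ + (const (+ 1) + const (+ 9) * s) * h₄)) * z
        + stretch (h₂ + s * (const (+ 3) * h₃ + (const (+ 3) + const (+ 9) * s) * h₄)) * (z * z) ∎)
    where
    σ = stretch s
    E₀ = stretch e₀
    E₁ = stretch e₁
    E₂ = stretch e₂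
    D₀ = stretch d₀
    D₁ = stretch d₁
    D₂ = stretch d₂
    h₀ = e₀ * d₀
    h₁ = e₀ * d₁ + e₁ * d₀
    h₂ = e₀ * d₂ + (e₁ * d₁ + e₂ * d₀)
    h₃ = e₁ * d₂ + e₂ * d₁
    h₄ = e₂ * d₂
    H₀ = stretch h₀
    H₁ = stretch h₁
    H₂ = stretch h₂
    H₃ = stretch h₃
    H₄ = stretch h₄
    h₃∈ = +∈ (*∈ p₁ r₂) (*∈ p₂ r₁)
    h₄∈ = *∈ p₂ r₂
    H₁≈ : H₁ ≈ E₀ * D₁ + E₁ * D₀
    H₁≈ = ≈-trans (stretch-+ _ _) (+-cong (stretch-* _ _) (stretch-* _ _))
    H₂≈ : H₂ ≈ E₀ * D₂ + (E₁ * D₁ + E₂ * D₀)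
    H₂≈ = ≈-trans (stretch-+ _ _) (+-cong (stretch-* _ _) (≈-trans (stretch-+ _ _) (+-cong (stretch-* _ _) (stretch-* _ _))))
    H₃≈ : H₃ ≈ E₁ * D₂ + E₂ * D₁
    H₃≈ = ≈-trans (stretch-+ _ _) (+-cong (stretch-* _ _) (stretch-* _ _))
    stretch-e : ∀ h k → stretch (h + s * (const (+ 3) * h₃ + (const (+ k) + const (+ 9) * s) * h₄))
      ≈ stretch h + σ * (const (+ 3) * H₃ + (const (+ k) + const (+ 9) * σ) * H₄)
    stretch-e h k = ≈-trans (stretch-+ _ _) (+-cong ≈-refl (≈-trans (stretch-* _ _) (*-cong ≈-refl
      (≈-trans (stretch-+ _ _) (+-cong (stretch-const-* _ _) (≈-trans (stretch-* _ _) (*-cong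
        (≈-trans (stretch-+ _ _) (+-cong (stretch-const _) (stretch-const-* _ s))) ≈-refl)))))))

-- Divisibility of sections of (φ(E)⁹ / E¹⁵) ℤ[s].

module SectionsOfMultiples where
  open FormalPowerSeries
  open Dissection
  open CubicRelation

  open SetoidReasoning setoid

  -- Unlike in `Expansion`, the coefficients are indices: their explicit values after five
  -- multiplications by y enter a polynomial identity.
  record Quadratic (e₀ e₁ e₂ f : PowerSeries) : Set where
    constructor quadratic
    field equation : f ≈ stretch e₀ + stretch e₁ * y + stretch e₂ * (y * y)

  -- Multiplication by y acts on the coordinates as the companion matrix of the cubic `y³≈`.
  y*-quadratic : ∀ {e₀ e₁ e₂ f} → Quadratic e₀ e₁ e₂ f →
    Quadratic (t * e₂) (e₀ + const (+ 9) * (t * e₂)) (e₁ + const (+ 27) * (t * e₂)) (y * f)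
  y*-quadratic {e₀} {e₁} {e₂} {f} (quadratic p) = quadratic (begin
    y * f
      ≈⟨ *-cong ≈-refl p ⟩
    y * (stretch e₀ + stretch e₁ * y + stretch e₂ * (y * y))
      ≈⟨ solve 4 (λ y a b c → y :* (a :+ b :* y :+ c :* (y :* y)) := a :* y :+ b :* (y :* y) :+ c :* :cube y) ≈-refl y _ _ _ ⟩
    stretch e₀ * y + stretch e₁ * (y * y) + stretch e₂ * cube y
      ≈⟨ +-cong ≈-refl (*-cong ≈-refl y³≈) ⟩
    stretch e₀ * y + stretch e₁ * (y * y) + stretch e₂ * (stretch t * (1s + const (+ 9) * y + const (+ 27) * (y * y)))
      ≈⟨ solve 5 (λ y t a b c → a :* y :+ b :* (y :* y) :+ c :* (t :* (num 1 :+ num 9 :* y :+ num 27 :* (y :* y)))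
           := t :* c :+ (a :+ num 9 :* (t :* c)) :* y :+ (b :+ num 27 :* (t :* c)) :* (y :* y)) ≈-refl y (stretch t) _ _ _ ⟩
    stretch t * stretch e₂ + (stretch e₀ + const (+ 9) * (stretch t * stretch e₂)) * y
      + (stretch e₁ + const (+ 27) * (stretch t * stretch e₂)) * (y * y)
      ≈⟨ +-cong (+-cong (stretch-* t e₂) (*-cong (linear e₀ (+ 9)) ≈-refl)) (*-cong (linear e₁ (+ 27)) ≈-refl) ⟨
    stretch (t * e₂) + stretch (e₀ + const (+ 9) * (t * e₂)) * y + stretch (e₁ + const (+ 27) * (t * e₂)) * (y * y) ∎)
    where
    linear : ∀ e k → stretch (e + const k * (t * e₂)) ≈ stretch e + const k * (stretch t * stretch e₂)
    linear e k = ≈-trans (stretch-+ _ _) (+-cong ≈-refl (≈-trans (stretch-const-* k _) (*-cong ≈-refl (stretch-* t e₂))))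

  section₀-quadratic : ∀ {e₀ e₁ e₂ f} → Quadratic e₀ e₁ e₂ f →
    section 0F f ≈ e₀ + e₁ * (const (+ 9) * t) + e₂ * (const (+ 6) * t + const (+ 243) * (t * t))
  section₀-quadratic {e₀} {e₁} {e₂} {f} (quadratic p) = begin
    section 0F f
      ≈⟨ ≈-trans (section-cong 0F p) (≈-trans (section-+ 0F _ _) (+-cong (section-+ 0F _ _) ≈-refl)) ⟩
    section 0F (stretch e₀) + section 0F (stretch e₁ * y) + section 0F (stretch e₂ * (y * y))
      ≈⟨ +-cong (+-cong (section-stretch₀ e₀) (≈-trans (section-stretch-* 0F e₁ y) (*-cong ≈-refl section₀-y)))
           (≈-trans (section-stretch-* 0F e₂ (y * y)) (*-cong ≈-refl section₀-y²)) ⟩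
    e₀ + e₁ * (const (+ 9) * t) + e₂ * (const (+ 6) * t + const (+ 243) * (t * t)) ∎

  -- It suffices that S₀ of y⁵, y⁵z and y⁵z² is 3t² times a polynomial in s. For y⁵ the leading
  -- coefficient is 15; for y⁵z the factor 3 comes from z = 3y alone, as S₀(y⁶) = t² + ... .
  section₀-y⁵* : ∀ {f} → f ∈ℤ[ s ] →
    ∃[ g ] g ∈ℤ[ s ] × section 0F (y * (y * (y * (y * (y * f))))) ≈ const (+ 3) * (t * t) * g
  section₀-y⁵* {f} f∈ with expand f∈
  ... | expansion {e₀} {e₁} {e₂} p₀ p₁ p₂ p =
    horner k₅ s * e₀ + horner k₆ s * e₁ + horner k₇ s * e₂ ,
    +∈ (+∈ (*∈ (horner∈ k₅) p₀) (*∈ (horner∈ k₆) p₁)) (*∈ (horner∈ k₇) p₂) ,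
    ≈-trans (section₀-quadratic (y*-quadratic (y*-quadratic (y*-quadratic (y*-quadratic (y*-quadratic inY))))))
      (solve 4 (λ t a b′ c′ →
         let s = num 27 :* t ; b = num 3 :* b′ ; c = num 9 :* c′
             -- (aᵢ, bᵢ, cᵢ) are the coordinates of yⁱ f in 1, y, y²; b′ and c′ are the initial
             -- coordinates in z and z².
             a₁ = t :* c ; b₁ = a :+ num 9 :* (t :* c) ; c₁ = b :+ num 27 :* (t :* c)
             a₂ = t :* c₁ ; b₂ = a₁ :+ num 9 :* (t :* c₁) ; c₂ = b₁ :+ num 27 :* (t :* c₁)
             a₃ = t :* c₂ ; b₃ = a₂ :+ num 9 :* (t :* c₂) ; c₃ = b₂ :+ num 27 :* (t :* c₂)
             a₄ = t :* c₃ ; b₄ = a₃ :+ num 9 :* (t :* c₃) ; c₄ = b₃ :+ num 27 :* (t :* c₃)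
             a₅ = t :* c₄ ; b₅ = a₄ :+ num 9 :* (t :* c₄) ; c₅ = b₄ :+ num 27 :* (t :* c₄)
         in a₅ :+ b₅ :* (num 9 :* t) :+ c₅ :* (num 6 :* t :+ num 243 :* (t :* t))
            := num 3 :* (t :* t) :* (:horner k₅ s :* a :+ :horner k₆ s :* b′ :+ :horner k₇ s :* c′))
         ≈-refl t e₀ e₁ e₂)
    where
    horner : List ℕ → PowerSeries → PowerSeries
    horner []       x = 0s
    horner (k ∷ ks) x = const (+ k) + x * horner ks x
    horner∈ : ∀ {x} ks → horner ks x ∈ℤ[ x ]
    horner∈ []       = const∈ _
    horner∈ (k ∷ ks) = +∈ (const∈ _) (*∈ gen∈ (horner∈ ks))
    :horner : ∀ {n} → List ℕ → Polynomial n → Polynomial n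
    :horner []       x = num 0
    :horner (k ∷ ks) x = num k :+ x :* :horner ks x
    -- Coefficients in s of the sections S₀(y⁵zⁱ)/(3t²), i = 0, 1, 2.
    k₅ k₆ k₇ : List ℕ
    k₅ = 5 ∷ 60 ∷ 135 ∷ 81 ∷ []
    k₆ = 1 ∷ 54 ∷ 297 ∷ 486 ∷ 243 ∷ []
    k₇ = 0 ∷ 28 ∷ 378 ∷ 1323 ∷ 1701 ∷ 729 ∷ []
    inY : Quadratic e₀ (const (+ 3) * e₁) (const (+ 9) * e₂) f
    inY = quadratic (begin
      f ≈⟨ p ⟩
      stretch e₀ + stretch e₁ * z + stretch e₂ * (z * z)
        ≈⟨ solve 4 (λ y a b c → let z = num 3 :* y in a :+ b :* z :+ c :* (z :* z)
             := a :+ num 3 :* b :* y :+ num 9 :* c :* (y :* y)) ≈-refl y _ _ _ ⟩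
      stretch e₀ + const (+ 3) * stretch e₁ * y + const (+ 9) * stretch e₂ * (y * y)
        ≈⟨ +-cong (+-cong ≈-refl (*-cong (stretch-const-* (+ 3) e₁) ≈-refl)) (*-cong (stretch-const-* (+ 9) e₂) ≈-refl) ⟨
      stretch e₀ + stretch (const (+ 3) * e₁) * y + stretch (const (+ 9) * e₂) * (y * y) ∎)

  -- y⁵ is q⁵ times c⁵ times a series in q³. The power q⁵ sends the exponent 3n + 1 to 3(n + 2),
  -- which yields S₀ and a carry q².
  section₁-c⁵* : ∀ f → q * (q * (pow5 b * section 1F (pow5 c * f))) ≈ section 0F (y * (y * (y * (y * (y * f)))))
  section₁-c⁵* f = begin
    q * (q * (pow5 b * section 1F (pow5 c * f)))
      ≈⟨ *-cong ≈-refl (*-cong ≈-refl (section-stretch-* 1F (pow5 b) _)) ⟨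
    q * (q * section 1F g)
      ≈⟨ *-cong ≈-refl (*-cong ≈-refl (section-q*₂ _)) ⟨
    q * (q * section 2F (q * g))
      ≈⟨ *-cong ≈-refl (section-q*₀ (q * g)) ⟨
    q * section 0F (q * (q * g))
      ≈⟨ *-cong ≈-refl (≈-trans (section-q*₂ _) (section-q*₁ _)) ⟨
    q * section 2F (q * (q * (q * (q * g))))
      ≈⟨ section-q*₀ _ ⟨
    section 0F (q * (q * (q * (q * (q * g)))))
      ≈⟨ section-cong 0F (≈-trans
           (*-cong ≈-refl (*-cong ≈-refl (*-cong ≈-refl (*-cong ≈-refl (*-cong ≈-refl (*-cong (stretch-pow5 b) ≈-refl))))))
           (solve 4 (λ q b c f → let y = q :* b :* c in
              q :* (q :* (q :* (q :* (q :* (:5 b :* (:5 c :* f)))))) := y :* (y :* (y :* (y :* (y :* f)))))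
              ≈-refl q (stretch b) c f)) ⟩
    section 0F (y * (y * (y * (y * (y * f))))) ∎
    where
    g = stretch (pow5 b) * (pow5 c * f)
  -- The series φ(E)⁹ / E¹⁵.
  c⁵b³ : PowerSeries
  c⁵b³ = pow5 c * cube b

  -- b³ is the stretch of C³ and so passes through the section.
  section-c⁵b³* : ∀ r f → section r (c⁵b³ * f) ≈ cube C * section r (pow5 c * f)
  section-c⁵b³* r f = ≈-trans (section-cong r (begin
    pow5 c * cube b * f ≈⟨ solve 3 (λ a b c → a :* b :* c := b :* (a :* c)) ≈-refl _ _ _ ⟩
    cube b * (pow5 c * f) ≈⟨ *-cong (stretch-cube C) ≈-refl ⟨
    stretch (cube C) * (pow5 c * f) ∎))
    (section-stretch-* r (cube C) _)

  -- The q² in t² cancels, leaving κ²b⁶ = c⁸b⁸. This splits as c³b⁵, cancelled by C³ and φ(c)⁵,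
  -- times c⁵b³: the prefactor reproduces itself and only the 3 is gained.
  section₁-c⁵b³* : ∀ {f} → f ∈ℤ[ s ] → ∃[ g ] g ∈ℤ[ s ] × section 1F (c⁵b³ * f) ≈ const (+ 3) * (c⁵b³ * g)
  section₁-c⁵b³* {f} f∈ = let g , g∈ , p = section₀-y⁵* f∈ in g , g∈ , divideOut g p
    where
    S = section 1F (pow5 c * f)
    pow5-1 : ∀ {x} → x ≈ 1s → pow5 x ≈ 1s
    pow5-1 p = ≈-trans (pow5-cong p) (solve 0 (:5 (num 1) := num 1) ≈-refl)
    divideOut : ∀ g → section 0F (y * (y * (y * (y * (y * f))))) ≈ const (+ 3) * (t * t) * g →
      section 1F (c⁵b³ * f) ≈ const (+ 3) * (c⁵b³ * g)
    divideOut g p = begin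
      section 1F (c⁵b³ * f)
        ≈⟨ section-c⁵b³* 1F f ⟩
      cube C * S
        ≈⟨ *-cong ≈-refl (≈-trans (≈-sym (*-identityˡ S)) (*-cong (≈-sym (pow5-1 stretch-c*b≈1)) ≈-refl)) ⟩
      cube C * (pow5 (stretch c * b) * S)
        ≈⟨ solve 4 (λ x c b S → x :* (:5 (c :* b) :* S) := x :* :5 c :* (:5 b :* S)) ≈-refl (cube C) (stretch c) b S ⟩
      cube C * pow5 (stretch c) * (pow5 b * S)
        ≈⟨ *-cong ≈-refl b⁵S≈ ⟩
      cube C * pow5 (stretch c) * (const (+ 3) * (κ * cube b * (κ * cube b)) * g)
        ≈⟨ *-cong ≈-refl (*-cong (*-cong ≈-refl (solve 2 (λ c b → let k = :4 c :* b in
             k :* :cube b :* (k :* :cube b) := :cube c :* :5 b :* (:5 c :* :cube b)) ≈-refl c b)) ≈-refl) ⟩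
      cube C * pow5 (stretch c) * (const (+ 3) * (cube c * pow5 b * c⁵b³) * g)
        ≈⟨ solve 6 (λ C³ d⁵ c³ b⁵ x g → C³ :* d⁵ :* (num 3 :* (c³ :* b⁵ :* x) :* g)
             := C³ :* c³ :* (d⁵ :* b⁵) :* (num 3 :* (x :* g))) ≈-refl (cube C) _ (cube c) (pow5 b) c⁵b³ g ⟩
      cube C * cube c * (pow5 (stretch c) * pow5 b) * (const (+ 3) * (c⁵b³ * g))
        ≈⟨ *-cong (*-cong (solve 2 (λ x y → :cube x :* :cube y := :cube (x :* y)) ≈-refl C c)
             (solve 2 (λ x y → :5 x :* :5 y := :5 (x :* y)) ≈-refl (stretch c) b)) ≈-refl ⟩
      cube (C * c) * pow5 (stretch c * b) * (const (+ 3) * (c⁵b³ * g))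
        ≈⟨ *-cong (*-cong (cube-cong C*c≈1) (pow5-cong stretch-c*b≈1)) ≈-refl ⟩
      cube 1s * pow5 1s * (const (+ 3) * (c⁵b³ * g))
        ≈⟨ solve 1 (λ x → :cube (num 1) :* :5 (num 1) :* x := x) ≈-refl _ ⟩
      const (+ 3) * (c⁵b³ * g) ∎
      where
      b⁵S≈ : pow5 b * S ≈ const (+ 3) * (κ * cube b * (κ * cube b)) * g
      b⁵S≈ = q-*-injective (q-*-injective (≈-trans (section₁-c⁵* f) (≈-trans p
        (solve 4 (λ q k b g → let t = k :* (q :* :cube b) in
           num 3 :* (t :* t) :* g := q :* (q :* (num 3 :* (k :* :cube b :* (k :* :cube b)) :* g))) ≈-refl q κ b g))))

  -- Modulo 27 the generator s disappears, so for the second congruence only the section of c⁵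
  -- itself remains to be examined.
  affine-mod-27 : ∀ {f} → f ∈ℤ[ s ] → ∃[ k ] ∃[ g ] f ≈ const k + const (+ 27) * g
  affine-mod-27 (const∈ k) = k , 0s , solve 1 (λ k → k := k :+ num 27 :* num 0) ≈-refl (const k)
  affine-mod-27 gen∈ = 0ℤ , t , solve 1 (λ t → num 27 :* t := num 0 :+ num 27 :* t) ≈-refl t
  affine-mod-27 (+∈ f∈ g∈) with affine-mod-27 f∈ | affine-mod-27 g∈
  ... | k , u , p | l , v , r = k ℤ.+ l , u + v , (begin
    _                                                       ≈⟨ +-cong p r ⟩
    const k + const (+ 27) * u + (const l + const (+ 27) * v)
      ≈⟨ solve 4 (λ k l u v → k :+ num 27 :* u :+ (l :+ num 27 :* v) := k :+ l :+ num 27 :* (u :+ v)) ≈-refl _ _ u v ⟩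
    const k + const l + const (+ 27) * (u + v)              ≈⟨ +-cong (const-+ k l) ≈-refl ⟨
    const (k ℤ.+ l) + const (+ 27) * (u + v)                ∎)
  affine-mod-27 (*∈ f∈ g∈) with affine-mod-27 f∈ | affine-mod-27 g∈
  ... | k , u , p | l , v , r = k ℤ.* l , const k * v + (const l + const (+ 27) * v) * u , (begin
    _                                                       ≈⟨ *-cong p r ⟩
    (const k + const (+ 27) * u) * (const l + const (+ 27) * v)
      ≈⟨ solve 4 (λ k l u v → (k :+ num 27 :* u) :* (l :+ num 27 :* v)
           := k :* l :+ num 27 :* (k :* v :+ (l :+ num 27 :* v) :* u)) ≈-refl _ _ u v ⟩
    const k * const l + const (+ 27) * (const k * v + (const l + const (+ 27) * v) * u) ≈⟨ +-cong (const-* k l) ≈-refl ⟨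
    const (k ℤ.* l) + const (+ 27) * (const k * v + (const l + const (+ 27) * v) * u) ∎)

  -- B is q times a series in q³, so class 2 starts with the B² term of (A² + 3AB + 9B²)⁵. Its
  -- coefficient is 45 + 90 = 135 = 5 · 27, and from B³ on every coefficient is divisible by 27.
  27∣section₂-c⁵ : ∃[ g ] section 2F (pow5 c) ≈ const (+ 27) * g
  27∣section₂-c⁵ = κ⁵ * (const (+ 5) * (a⁸ * (b * b))) + section 2F tail , (begin
    section 2F (pow5 c)
      ≈⟨ section-cong 2F (≈-trans (pow5-cong c≈) (≈-trans
           (solve 2 (λ k m → :5 (k :* m) := :5 k :* :5 m) ≈-refl (stretch κ) numerator)
           (≈-trans (*-cong ≈-refl (numerator⁵ A B))
             (solve 6 (λ k q x y b w →
               k :* (x :* (y :* y) :+ num 15 :* (x :* y :* (q :* b)) :+ num 135 :* (x :* (q :* b :* (q :* b))) :+ num 27 :* w)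
               := k :* (x :* (y :* y)) :+ q :* (k :* (num 15 :* (x :* y :* b))) :+ q :* (q :* (k :* (num 135 :* (x :* (b :* b)))))
                  :+ num 27 :* (k :* w)) ≈-refl K q (pow4 A * pow4 A) A (stretch b) (tail₀ A B))))) ⟩
    section 2F (K * (pow4 A * pow4 A * (A * A)) + q * (K * (const (+ 15) * (pow4 A * pow4 A * A * stretch b)))
      + q * (q * (K * (const (+ 135) * (pow4 A * pow4 A * (stretch b * stretch b))))) + const (+ 27) * tail)
      ≈⟨ section-cong 2F (+-cong (+-cong (+-cong
           (≈-trans (stretch-* _ _) (*-cong K≈ (≈-trans (stretch-* _ _) (*-cong A⁸≈ (stretch-* a a)))))
           (*-cong ≈-refl (≈-trans (stretch-* _ _) (*-cong K≈ (≈-trans (stretch-const-* _ _) (*-cong ≈-refl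
              (≈-trans (stretch-* _ _) (*-cong (≈-trans (stretch-* _ _) (*-cong A⁸≈ ≈-refl)) ≈-refl))))))))
           (*-cong ≈-refl (*-cong ≈-refl (≈-trans (stretch-* _ _) (*-cong K≈ (≈-trans (stretch-const-* _ _) (*-cong ≈-refl
              (≈-trans (stretch-* _ _) (*-cong A⁸≈ (stretch-* b b)))))))))) ≈-refl) ⟨
    section 2F (dissection (κ⁵ * (a⁸ * (a * a))) (κ⁵ * (const (+ 15) * (a⁸ * a * b))) (κ⁵ * (const (+ 135) * (a⁸ * (b * b))))
      + const (+ 27) * tail)
      ≈⟨ ≈-trans (section-+ 2F _ _) (+-cong (section-dissection₂ _ _ _) (section-const-* 2F (+ 27) tail)) ⟩
    κ⁵ * (const (+ 135) * (a⁸ * (b * b))) + const (+ 27) * section 2F tail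
      ≈⟨ solve 3 (λ k x y → k :* (num 135 :* x) :+ num 27 :* y := num 27 :* (k :* (num 5 :* x) :+ y)) ≈-refl κ⁵ _ _ ⟩
    const (+ 27) * (κ⁵ * (const (+ 5) * (a⁸ * (b * b))) + section 2F tail) ∎)
    where
    tail₀ : PowerSeries → PowerSeries → PowerSeries
    tail₀ A B = cube B * (const (+ 30) * (pow4 A * cube A) + const (+ 135) * (cube A * cube A * B)
      + const (+ 459) * (pow5 A * (B * B)) + const (+ 1215) * (pow4 A * cube B)
      + const (+ 2430) * (cube A * pow4 B) + const (+ 3645) * (A * A * pow5 B)
      + const (+ 3645) * (A * (cube B * cube B)) + const (+ 2187) * (pow4 B * cube B))
    numerator⁵ : ∀ A B → pow5 (A * A + const (+ 3) * (A * B) + const (+ 9) * (B * B)) ≈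
      pow4 A * pow4 A * (A * A) + const (+ 15) * (pow4 A * pow4 A * A * B)
        + const (+ 135) * (pow4 A * pow4 A * (B * B)) + const (+ 27) * tail₀ A B
    numerator⁵ A B = solve 2 (λ A B →
      :5 (A :* A :+ num 3 :* (A :* B) :+ num 9 :* (B :* B))
      := :4 A :* :4 A :* (A :* A) :+ num 15 :* (:4 A :* :4 A :* A :* B)
         :+ num 135 :* (:4 A :* :4 A :* (B :* B))
         :+ num 27 :* (:cube B :* (num 30 :* (:4 A :* :cube A) :+ num 135 :* (:cube A :* :cube A :* B)
              :+ num 459 :* (:5 A :* (B :* B)) :+ num 1215 :* (:4 A :* :cube B)
              :+ num 2430 :* (:cube A :* :4 B) :+ num 3645 :* (A :* A :* :5 B)
              :+ num 3645 :* (A :* (:cube B :* :cube B)) :+ num 2187 :* (:4 B :* :cube B))))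
      ≈-refl A B
    K κ⁵ a⁸ tail : PowerSeries
    K = pow5 (stretch κ)
    κ⁵ = pow5 κ
    a⁸ = pow4 a * pow4 a
    tail = K * tail₀ A B
    K≈ : stretch κ⁵ ≈ K
    K≈ = stretch-pow5 κ
    A⁸≈ : stretch a⁸ ≈ pow4 A * pow4 A
    A⁸≈ = ≈-trans (stretch-* _ _) (*-cong (stretch-pow4 a) (stretch-pow4 a))

  27∣section₂-c⁵b³* : ∀ {f} → f ∈ℤ[ s ] → ∃[ g ] section 2F (c⁵b³ * f) ≈ const (+ 27) * g
  27∣section₂-c⁵b³* {f} f∈ =
    let k , u , p = affine-mod-27 f∈
        v , r = 27∣section₂-c⁵
    in cube C * (const k * v + section 2F (pow5 c * u)) , factor k u v p r
    where
    factor : ∀ k u v → f ≈ const k + const (+ 27) * u → section 2F (pow5 c) ≈ const (+ 27) * v →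
      section 2F (c⁵b³ * f) ≈ const (+ 27) * (cube C * (const k * v + section 2F (pow5 c * u)))
    factor k u v p r = begin
      section 2F (c⁵b³ * f)
        ≈⟨ section-c⁵b³* 2F f ⟩
      cube C * section 2F (pow5 c * f)
        ≈⟨ *-cong ≈-refl (section-cong 2F (≈-trans (*-cong ≈-refl p)
             (solve 3 (λ x k u → x :* (k :+ num 27 :* u) := k :* x :+ num 27 :* (x :* u)) ≈-refl (pow5 c) (const k) u))) ⟩
      cube C * section 2F (const k * pow5 c + const (+ 27) * (pow5 c * u))
        ≈⟨ *-cong ≈-refl (≈-trans (section-+ 2F _ _) (+-cong (≈-trans (section-const-* 2F k _) (*-cong ≈-refl r)) (section-const-* 2F (+ 27) _))) ⟩
      cube C * (const k * (const (+ 27) * v) + const (+ 27) * section 2F (pow5 c * u))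
        ≈⟨ solve 4 (λ C k v w → C :* (k :* (num 27 :* v) :+ num 27 :* w) := num 27 :* (C :* (k :* v :+ w))) ≈-refl _ _ v _ ⟩
      const (+ 27) * (cube C * (const k * v + section 2F (pow5 c * u))) ∎

-- The generating function of p33.

module GeneratingFunction where
  open FormalPowerSeries
  open Dissection
  open Truncation
  open EulerProduct
  open Norm
  open CubicRelation

  open SetoidReasoning setoid

  p33Series : PowerSeries
  p33Series = fromℕSeries p33

  genSeries-* : ∀ N → cube (stretch (P N)) * cube (P N) * fromℕSeries (genSeries N) ≈ 1s
  genSeries-* N = begin
    cube Q * cube p * fromℕSeries (genSeries N)
      ≈⟨ solve 3 (λ a b c → :cube a :* :cube b :* c := b :* (b :* (b :* (a :* (a :* (a :* c)))))) ≈-refl Q p _ ⟩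
    p * (p * (p * (Q * (Q * (Q * fromℕSeries (genSeries N))))))
      ≈⟨ *-cong ≈-refl (*-cong ≈-refl (*-cong ≈-refl (≈-trans (*-cong ≈-refl (≈-trans (*-cong ≈-refl (divide₃ _)) (divide₃ _))) (divide₃ _)))) ⟩
    p * (p * (p * fromℕSeries (divPoch 1 N (divPoch 1 N (divPoch 1 N one)))))
      ≈⟨ ≈-trans (*-cong ≈-refl (≈-trans (*-cong ≈-refl (divide₁ _)) (divide₁ _))) (divide₁ _) ⟩
    fromℕSeries one
      ≈⟨ fromℕSeries-one ⟩
    1s ∎
    where
    p = P N
    Q = stretch (P N)
    divide₁ : ∀ f → p * fromℕSeries (divPoch 1 N f) ≈ fromℕSeries f
    divide₁ f = ≈-trans (*-cong (poch-cong N (≈-sym (*-identityʳ q))) ≈-refl) (poch-*-divPoch 0 N f)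
    divide₃ : ∀ f → Q * fromℕSeries (divPoch 3 N f) ≈ fromℕSeries f
    divide₃ f = ≈-trans (*-cong (≈-trans (stretch-poch q N) (poch-cong N (≈-trans stretch-q
      (solve 1 (λ q → q :* (q :* q) := q :* (q :* (q :* num 1))) ≈-refl q)))) ≈-refl) (poch-*-divPoch 2 N f)

  -- The value at N is read from a product truncated at N, so the comparison with the infinite
  -- product is made for each N separately, at precision N + 1.
  p33Series≈ : p33Series ≈ stretch c * c
  p33Series≈ = pointwise λ N → ≡.trans
    (coeff (genSeries≈ N) N)
    (≡.sym (coeff-below (cc≈ N) N (ℕ.n<1+n N)))
    where
    inverse : ∀ N → PowerSeries
    inverse N = cube (stretch (1/P N)) * cube (1/P N)
    genSeries≈ : ∀ N → fromℕSeries (genSeries N) ≈ inverse N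
    genSeries≈ N = begin
      G
        ≈⟨ *-identityˡ G ⟨
      1s * G
        ≈⟨ *-cong (≈-trans (*-cong (cube-cong stretch-P-*-1/P) (cube-cong (P-*-1/P N)))
             (solve 0 (:cube (num 1) :* :cube (num 1) := num 1) ≈-refl)) ≈-refl ⟨
      cube (stretch (P N) * stretch (1/P N)) * cube (P N * 1/P N) * G
        ≈⟨ solve 5 (λ a b c d g → :cube (a :* b) :* :cube (c :* d) :* g
             := :cube b :* :cube d :* (:cube a :* :cube c :* g)) ≈-refl _ _ _ _ G ⟩
      inverse N * (cube (stretch (P N)) * cube (P N) * G)
        ≈⟨ *-cong ≈-refl (genSeries-* N) ⟩
      inverse N * 1s
        ≈⟨ *-identityʳ _ ⟩
      inverse N ∎
      where
      G = fromℕSeries (genSeries N)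
      stretch-P-*-1/P : stretch (P N) * stretch (1/P N) ≈ 1s
      stretch-P-*-1/P = ≈-trans (≈-sym (stretch-* _ _)) (≈-trans (stretch-cong (P-*-1/P N)) (stretch-const 1ℤ))
    cc≈ : ∀ N → stretch c * c ≈[ suc N ] inverse N
    cc≈ N = ≈[]-trans (≈⇒≈[] (*-cong (stretch-cube 1/E) ≈-refl))
      (*-cong[] (cube-cong[] (stretch-cong[] (1/E-trunc N))) (cube-cong[] (1/E-trunc N)))

-- Iterated sections and arithmetic progressions.

module Progressions where
  open FormalPowerSeries
  open Dissection
  open CubicRelation
  open SectionsOfMultiples
  open GeneratingFunction

  open SetoidReasoning setoid

  -- With α = m + 1 the coefficients are p33(3^α n + (3^α + 1)/2). In base 3 the offset (3^α + 1)/2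
  -- reads 1...12: its last digit is 2 and all others are 1, hence S₂ once and S₁ afterwards.
  progression : ℕ → PowerSeries
  progression zero    = section 2F p33Series
  progression (suc m) = section 1F (progression m)

  progression≈ : ∀ m → ∃[ g ] g ∈ℤ[ s ] × progression m ≈ const (+ (3 ℕ.^ (2 ℕ.+ m))) * (c⁵b³ * g)
  progression≈ zero = 1s , const∈ 1ℤ , (begin
    section 2F p33Series
      ≈⟨ section-cong 2F p33Series≈ ⟩
    section 2F (stretch c * c)
      ≈⟨ section-stretch-* 2F c c ⟩
    c * section 2F c
      -- The initial factor 9 is the coefficient of B² in `numerator`.
      ≈⟨ *-cong ≈-refl (≈-trans (section-cong 2F dissection-c) (section-dissection₂ _ _ _)) ⟩
    c * (κ * (const (+ 9) * (b * b)))
      ≈⟨ solve 2 (λ c b → c :* (:4 c :* b :* (num 9 :* (b :* b))) := num 9 :* (:5 c :* :cube b :* num 1)) ≈-refl c b ⟩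
    const (+ 9) * (c⁵b³ * 1s) ∎)
  progression≈ (suc m) =
    let g , g∈ , p = progression≈ m
        h , h∈ , r = section₁-c⁵b³* g∈
    in h , h∈ , step g h p r
    where
    n = 3 ℕ.^ (2 ℕ.+ m)
    step : ∀ g h → progression m ≈ const (+ n) * (c⁵b³ * g) → section 1F (c⁵b³ * g) ≈ const (+ 3) * (c⁵b³ * h) →
      section 1F (progression m) ≈ const (+ (3 ℕ.* n)) * (c⁵b³ * h)
    step g h p r = begin
      section 1F (progression m)
        ≈⟨ section-cong 1F p ⟩
      section 1F (const (+ n) * (c⁵b³ * g))
        ≈⟨ ≈-trans (section-const-* 1F (+ n) _) (*-cong ≈-refl r) ⟩
      const (+ n) * (const (+ 3) * (c⁵b³ * h))
        ≈⟨ solve 2 (λ k x → k :* (num 3 :* x) := num 3 :* k :* x) ≈-refl (const (+ n)) _ ⟩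
      const (+ 3) * const (+ n) * (c⁵b³ * h)
        ≈⟨ *-cong (const-* (+ 3) (+ n)) ≈-refl ⟨
      const (+ 3 ℤ.* + n) * (c⁵b³ * h)
        ≈⟨ *-cong (≈-reflexive (cong const (≡.sym (ℤ.pos-* 3 n)))) ≈-refl ⟩
      const (+ (3 ℕ.* n)) * (c⁵b³ * h) ∎

  section₂-progression : ∀ m → ∃[ g ] section 2F (progression m) ≈ const (+ (3 ℕ.^ (5 ℕ.+ m))) * g
  section₂-progression m =
    let f , f∈ , p = progression≈ m
        g , r = 27∣section₂-c⁵b³* f∈
    in g , factor f g p r
    where
    n = 3 ℕ.^ (2 ℕ.+ m)
    n*27≡ : n ℕ.* 27 ≡ 3 ℕ.^ (5 ℕ.+ m)
    n*27≡ = ≡.trans (≡.sym (ℕ.^-distribˡ-+-* 3 (2 ℕ.+ m) 3)) (cong (3 ℕ.^_) (ℕ.+-comm (2 ℕ.+ m) 3))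
    factor : ∀ f g → progression m ≈ const (+ n) * (c⁵b³ * f) → section 2F (c⁵b³ * f) ≈ const (+ 27) * g →
      section 2F (progression m) ≈ const (+ (3 ℕ.^ (5 ℕ.+ m))) * g
    factor f g p r = begin
      section 2F (progression m)
        ≈⟨ ≈-trans (section-cong 2F p) (≈-trans (section-const-* 2F (+ n) _) (*-cong ≈-refl r)) ⟩
      const (+ n) * (const (+ 27) * g)
        ≈⟨ *-assoc _ _ g ⟨
      const (+ n) * const (+ 27) * g
        ≈⟨ *-cong (const-* (+ n) (+ 27)) ≈-refl ⟨
      const (+ n ℤ.* + 27) * g
        ≈⟨ *-cong (≈-reflexive (cong const (≡.trans (≡.sym (ℤ.pos-* n 27)) (cong +_ n*27≡)))) ≈-refl ⟩
      const (+ (3 ℕ.^ (5 ℕ.+ m))) * g ∎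

  thrice≡3* : ∀ n → thrice n ≡ 3 ℕ.* n
  thrice≡3* zero    = refl
  thrice≡3* (suc n) = ≡.trans (cong (3 ℕ.+_) (thrice≡3* n)) (≡.sym (ℕ.*-suc 3 n))

  -- (3^(m+1) + 1)/2, defined by recursion so that division enters only through `half`.
  offset : ℕ → ℕ
  offset zero    = 2
  offset (suc m) = 3 ℕ.^ suc m ℕ.+ offset m

  2*offset : ∀ m → offset m ℕ.* 2 ≡ 3 ℕ.^ suc m ℕ.+ 1
  2*offset zero    = refl
  2*offset (suc m) = ≡.trans (ℕ.*-distribʳ-+ 2 (3 ℕ.^ suc m) (offset m))
    (≡.trans (cong (3 ℕ.^ suc m ℕ.* 2 ℕ.+_) (2*offset m)) (lem (3 ℕ.^ suc m)))
    where
    lem : ∀ x → x ℕ.* 2 ℕ.+ (x ℕ.+ 1) ≡ 3 ℕ.* x ℕ.+ 1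
    lem = solve-∀

  half : ∀ m n → m ℕ.* 2 ≡ n → n ℕ./ 2 ≡ m
  half m _ refl = ℕ.m*n/n≡m m 2

  progression-coeff : ∀ m n → progression m n ≡ + p33 (3 ℕ.^ suc m ℕ.* n ℕ.+ offset m)
  progression-coeff zero n = ≡.trans (section-coeff 2F p33Series n)
    (cong (λ k → + p33 k) (≡.trans (cong (2 ℕ.+_) (thrice≡3* n)) (ℕ.+-comm 2 (3 ℕ.* n))))
  progression-coeff (suc m) n = ≡.trans (section-coeff 1F (progression m) n)
    (≡.trans (progression-coeff m (1 ℕ.+ thrice n)) (cong (λ k → + p33 k)
      (≡.trans (cong (λ k → 3 ℕ.^ suc m ℕ.* (1 ℕ.+ k) ℕ.+ offset m) (thrice≡3* n)) (lem (3 ℕ.^ suc m) n (offset m)))))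
    where
    lem : ∀ x n o → x ℕ.* (1 ℕ.+ 3 ℕ.* n) ℕ.+ o ≡ 3 ℕ.* x ℕ.* n ℕ.+ (x ℕ.+ o)
    lem = solve-∀

  divides-coeff : ∀ {f g : PowerSeries} {k l} n → f ≈ const (+ k) * g → f n ≡ + l → k ∣ l
  divides-coeff {f} {g} {k} {l} n p r = ∣⇒∣ᵤ (ℤ∣.divides (g n) (≡.trans (≡.sym r)
    (≡.trans (coeff p n) (≡.trans (const-*-coeff (+ k) g n) (ℤ.*-comm (+ k) (g n))))))

-- The two congruences.

open import Data.Nat using (_+_; _*_; _^_; _/_; _≤_)
open Dissection using (thrice; section-coeff)
open Progressions

theorem1p2 : (n α : ℕ) → 1 ≤ α →
    (3 ^ (α + 1) ∣ p33 (3 ^ α * n + (3 ^ α + 1) / 2))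
    × (3 ^ (α + 4) ∣ p33 (3 ^ (α + 1) * n + (5 * 3 ^ α + 1) / 2))
theorem1p2 n (suc m) _ = part₁ , part₂
  where
  x = 3 ^ suc m
  quotient₁ : (x + 1) / 2 ≡ offset m
  quotient₁ = half (offset m) (x + 1) (2*offset m)
  double : ∀ x o → (2 * x + o) * 2 ≡ 4 * x + o * 2
  double = solve-∀
  collect : ∀ x → 4 * x + (x + 1) ≡ 5 * x + 1
  collect = solve-∀
  quotient₂ : (5 * x + 1) / 2 ≡ 2 * x + offset m
  quotient₂ = half (2 * x + offset m) (5 * x + 1)
    (≡.trans (double x (offset m)) (≡.trans (cong (λ k → 4 * x + k) (2*offset m)) (collect x)))
  index : ∀ x n o → x * (2 + 3 * n) + o ≡ 3 * x * n + (2 * x + o)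
  index = solve-∀
  part₁ : 3 ^ (suc m + 1) ∣ p33 (x * n + (x + 1) / 2)
  part₁ = ≡.subst₂ (λ j k → 3 ^ j ∣ p33 (x * n + k)) (cong suc (ℕ.+-comm 1 m)) (≡.sym quotient₁)
    (divides-coeff n (proj₂ (proj₂ (progression≈ m))) (progression-coeff m n))
  part₂ : 3 ^ (suc m + 4) ∣ p33 (3 ^ (suc m + 1) * n + (5 * x + 1) / 2)
  -- The coefficients of class 2 have index 3^α(3n + 2) + (3^α + 1)/2, and 2 · 3^α + (3^α + 1)/2 =
  -- (5 · 3^α + 1)/2.
  part₂ = ≡.subst (λ j → 3 ^ (suc m + 4) ∣ p33 (3 ^ j * n + (5 * x + 1) / 2)) (cong suc (ℕ.+-comm 1 m))
    (≡.subst₂ (λ j k → 3 ^ j ∣ p33 (3 * x * n + k)) (cong suc (ℕ.+-comm 4 m)) (≡.sym quotient₂)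
      (divides-coeff n (proj₂ (section₂-progression m)) (≡.trans (section-coeff 2F (progression m) n)
        (≡.trans (progression-coeff m (2 + thrice n)) (cong (λ k → + p33 k)
          (≡.trans (cong (λ k → x * (2 + k) + offset m) (thrice≡3* n)) (index x n (offset m))))))))
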